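{- For every real $\lambda>0$, the algorithm BlockPacking with parameter $\lambda$ (defined in the context) has consistency $1+2/\lambda$ and robustness $2\lambda+4$ for general uncertainty sets and identical machines. That is, for all positive integers $m,n$, every nonempty bounded uncertainty set $\mathcal U\subseteq\mathbb R_{\ge0}^n$ of job-size vectors and every predicted scenario $\hat p\in\mathcal U$, the schedule $\mathcal S$ returned by BlockPacking satisfies $$C_{\max}(\mathcal S,\hat p)\le\Big(1+\frac2\lambda\Big)\mathrm{OPT}(\hat p)\quad\text{and}\quad \sup_{p\in\mathcal U}C_{\max}(\mathcal S,p)\le(2\lambda+4)\,\mathrm{OPT}^{\mathrm{rob}}(\mathcal U).$$
   Context: There are $m$ identical machines and $n$ jobs; a scenario is a vector $p\in\mathbb R_{\ge0}^n$ of job sizes. A schedule is a partition $\mathcal S=(S_1,\dots,S_m)$ of $[n]$ (parts may be empty), and $C_{\max}(\mathcal S,p)=\max_{i\in[m]}\sum_{j\in S_i}p_j$. $\mathrm{OPT}(p)=\min_{\mathcal S}C_{\max}(\mathcal S,p)$ and $\mathrm{OPT}^{\mathrm{rob}}(\mathcal U)=\min_{\mathcal S}\sup_{p\in\mathcal U}C_{\max}(\mathcal S,p)$. For a set $B$ of jobs write $\hat p(B)=\sum_{j\in B}\hat p_j$. Algorithm BlockPacking, on input $\hat p$, $\mathcal U$ and $\lambda>0$: 1. Let $(\hat S_1,\dots,\hat S_m)$ be a schedule minimizing $C_{\max}(\cdot,\hat p)$, and $(T_1,\dots,T_m)$ a schedule minimizing $\sup_{p\in\mathcal U}C_{\max}(\cdot,p)$.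 2. Let $\hat H=\{j\in[n]:\hat p_j>\mathrm{OPT}(\hat p)/\lambda\}$. For each $i\in[m]$ let $H_i=\hat S_i\cap\hat H$ and $y_i=\hat p(\hat S_i\setminus\hat H)$. 3. (Blocks.) For each $i\in[m]$, let $R=T_i\setminus\hat H$, ordered arbitrarily. While $\hat p(R)>\mathrm{OPT}(\hat p)/(2\lambda)$, let $B$ be the shortest prefix of $R$ with $\hat p(B)>\mathrm{OPT}(\hat p)/(2\lambda)$, declare $B$ a non-tiny block, and replace $R$ by $R\setminus B$. When the loop ends, if $R\ne\varnothing$, declare $R$ a tiny block. (So each $i$ yields at most one tiny block.) 4. Assign the tiny blocks injectively to distinct machines; let $L_i$ be the set of jobs in the tiny block assigned to machine $i$ (empty if there is none). 5. (First-crossing assignment.) Order the non-tiny blocks arbitrarily as $B^1,\dots,B^N$ and set $t=1$. For $i=1,\dots,m$ in order: if $t>N$, stop; else if $\sum_{s=t}^N\hat p(B^s)\le y_i$, add $B^t,\dots,B^N$ to $L_i$, set $t=N+1$, and stop; else let $\ell\ge t$ be the smallest index with $\sum_{s=t}^{\ell}\hat p(B^s)>y_i$, add $B^t,\dots,B^\ell$ to $L_i$, and set $t=\ell+1$. 6. Return $(H_1\cup L_1,\dots,H_m\cup L_m)$. The minimizations are exact; no running-time restriction is imposed. -}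

module Defs where

open import Algebra.Bundles using (CommutativeRing)
open import Algebra.Core using (Op₁; Op₂)
open import Algebra.Structures using (IsCommutativeRing)
import Algebra.Construct.NaturalChoice.Max as Max
import Algebra.Properties.Monoid.Sum as Sum
open import Data.Bool.Base using (true; false; if_then_else_)
open import Data.Fin.Base using (Fin; zero; finToFun; funToFin)
open import Data.Fin.Properties using (_≟_; finToFun-funToFin)
open import Data.Fin.Subset using (Subset; _∈_; _∩_; _∪_; _─_; ⁅_⁆; ⋃)
open import Data.List.Base as List
  using (List; []; _∷_; _++_; allFin; concat; concatMap; filter; foldr; map)
import Data.List.Extrema as Extrema
import Data.List.Membership.Propositional as List∈
open import Data.List.Membership.Propositional.Properties using (∈-allFin; ∈-map⁺)
open import Data.List.Relation.Binary.Permutation.Propositional using (_↭_)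
import Data.List.Relation.Unary.All as All
open import Data.List.Relation.Unary.Unique.Propositional using (Unique)
open import Data.Nat.Base using (ℕ; suc; _^_; NonZero)
open import Data.Product using (_×_; _,_; ∃; ∃!; proj₁; proj₂)
open import Data.Vec.Base using (Vec; []; _∷_; lookup; tabulate; replicate; foldr₁)
open import Data.Vec.Properties
  using (lookup∘tabulate; tabulate∘lookup; tabulate-cong; []=⇒lookup; lookup⇒[]=)
open import Data.Vec.Functional using (Vector)
open import Function.Base using (_∘_)
open import Function.Bundles using (_⇔_)
open import Level using (0ℓ) renaming (suc to lsuc)
open import Relation.Binary.Bundles using (DecTotalOrder; TotalOrder)
open import Relation.Binary.Core using (Rel)
import Relation.Binary.Properties.DecTotalOrder as DecTotalOrderProperties
open import Relation.Binary.Structures using (IsDecTotalOrder)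
import Relation.Binary.Construct.NonStrictToStrict as ToStrict
open import Relation.Binary.PropositionalEquality
  using (_≡_; _≢_; refl; sym; trans; cong; subst)
open import Relation.Nullary using (Dec; yes; no; does; ¬_; contradiction)
open import Relation.Unary using (Pred; Satisfiable)

-- The real numbers are given axiomatically: classically, this structure has
-- exactly one model up to isomorphism.

record CompleteOrderedField : Set₁ where
  infix  9 _⁻¹
  infix  8 -_
  infixl 7 _*_ _/_
  infixl 6 _+_
  infix  4 _≈_ _≤_
  field
    Carrier           : Set
    _≈_ _≤_           : Rel Carrier 0ℓ
    _+_ _*_           : Op₂ Carrier
    -_ _⁻¹            : Op₁ Carrier
    0# 1#             : Carrier
    isCommutativeRing : IsCommutativeRing _≈_ _+_ _*_ -_ 0# 1#
    0≉1               : ¬ 0# ≈ 1#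
    -- _⁻¹ is total, with an unspecified value at 0#.
    ⁻¹-inverseʳ       : ∀ x → ¬ x ≈ 0# → x * x ⁻¹ ≈ 1#
    isDecTotalOrder   : IsDecTotalOrder _≈_ _≤_
    +-monoˡ-≤         : ∀ {x y} z → x ≤ y → x + z ≤ y + z
    *-nonNegative     : ∀ {x y} → 0# ≤ x → 0# ≤ y → 0# ≤ x * y

  IsUpperBound : Pred Carrier 0ℓ → Pred Carrier 0ℓ
  IsUpperBound P b = ∀ x → P x → x ≤ b

  IsSupremum : Pred Carrier 0ℓ → Pred Carrier 0ℓ
  IsSupremum P s = IsUpperBound P s × (∀ b → IsUpperBound P b → s ≤ b)

  field
    complete : ∀ P → Satisfiable P → Satisfiable (IsUpperBound P) →
               Satisfiable (IsSupremum P)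

  commutativeRing : CommutativeRing 0ℓ 0ℓ
  commutativeRing = record { isCommutativeRing = isCommutativeRing }

  decTotalOrder : DecTotalOrder 0ℓ 0ℓ 0ℓ
  decTotalOrder = record { isDecTotalOrder = isDecTotalOrder }

  open DecTotalOrder decTotalOrder public using (totalOrder; _≤?_)
  open DecTotalOrderProperties decTotalOrder public using (_<_)

  _<?_ : ∀ x y → Dec (x < y)
  _<?_ = ToStrict.<-decidable _≈_ _≤_ (DecTotalOrder._≟_ decTotalOrder) _≤?_

  _/_ : Op₂ Carrier
  x / y = x * y ⁻¹

module Scheduling (ℝ : CompleteOrderedField) where

  open CompleteOrderedField ℝ
  open Max totalOrder using (_⊔_; ⊔-mono-≤)
  open Sum (CommutativeRing.+-monoid commutativeRing) using (sum)
  private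
    module R = CommutativeRing commutativeRing
    module O = DecTotalOrder decTotalOrder

  private variable
    m n : ℕ
    A   : Set

  Scenario : ℕ → Set
  Scenario n = Vector Carrier n

  record UncertaintySet (n : ℕ) : Set₁ where
    field
      scenarios   : Pred (Scenario n) 0ℓ
      nonNegative : ∀ p → scenarios p → ∀ j → 0# ≤ p j
      nonEmpty    : Satisfiable scenarios
      bounded     : ∃ λ M → ∀ p → scenarios p → ∀ j → p j ≤ M

  Family : ℕ → ℕ → Set
  Family m n = Vec (Subset n) m

  IsSchedule : Family m n → Set
  IsSchedule S = ∀ j → ∃! _≡_ λ i → j ∈ lookup S i

  size : Scenario n → Subset n → Carrier
  size p B = sum λ j → if lookup B j then p j else 0#

  maximum : .{{NonZero m}} → Vec Carrier m → Carrier
  maximum {m = suc _} = foldr₁ _⊔_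

  Cmax : .{{NonZero m}} → Family m n → Scenario n → Carrier
  Cmax S p = maximum (tabulate λ i → size p (lookup S i))

  -- Every function on schedules attains its minimum: a schedule is the family
  -- of fibres of an assignment of jobs to machines, and there are finitely
  -- many of these.

  IsMinimizer : (Family m n → Carrier) → Family m n → Set
  IsMinimizer f S = IsSchedule S × (∀ S′ → IsSchedule S′ → f S ≤ f S′)

  fibres : (Fin n → Fin m) → Family m n
  fibres a = tabulate λ i → tabulate λ j → does (a j ≟ i)

  lookup-fibres : (a : Fin n → Fin m) → ∀ i j →
                  lookup (lookup (fibres a) i) j ≡ does (a j ≟ i)
  lookup-fibres a i j = trans
    (cong (λ B → lookup B j) (lookup∘tabulate (λ i → tabulate λ j → does (a j ≟ i)) i))
    (lookup∘tabulate (λ j → does (a j ≟ i)) j)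

  does-refl : (i : Fin m) → does (i ≟ i) ≡ true
  does-refl i with i ≟ i
  ... | yes _  = refl
  ... | no i≢i = contradiction refl i≢i

  does-true : (i i′ : Fin m) → does (i ≟ i′) ≡ true → i ≡ i′
  does-true i i′ eq with i ≟ i′
  does-true i i′ eq | yes i≡i′ = i≡i′
  does-true i i′ () | no  _

  fibres-isSchedule : (a : Fin n → Fin m) → IsSchedule (fibres a)
  fibres-isSchedule a j =
    a j ,
    lookup⇒[]= j _ (trans (lookup-fibres a (a j) j) (does-refl (a j))) ,
    λ {i} j∈ → does-true (a j) i (trans (sym (lookup-fibres a i j)) ([]=⇒lookup j∈))

  fibres-cong : {a b : Fin n → Fin m} → (∀ j → a j ≡ b j) → fibres a ≡ fibres b
  fibres-cong a≗b =
    tabulate-cong λ i → tabulate-cong λ j → cong (λ k → does (k ≟ i)) (a≗b j)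

  schedule≡fibres : (S : Family m n) (sch : IsSchedule S) → fibres (proj₁ ∘ sch) ≡ S
  schedule≡fibres S sch = trans
    (tabulate-cong λ i → trans (tabulate-cong (entry i)) (tabulate∘lookup (lookup S i)))
    (tabulate∘lookup S)
    where
    entry : ∀ i j → does (proj₁ (sch j) ≟ i) ≡ lookup (lookup S i) j
    entry i j with proj₁ (sch j) ≟ i
    ... | yes refl = sym ([]=⇒lookup (proj₁ (proj₂ (sch j))))
    ... | no  a≢i with lookup (lookup S i) j in eq
    ...   | false = refl
    ...   | true  = contradiction (proj₂ (proj₂ (sch j)) (lookup⇒[]= j _ eq)) a≢i

  schedules : ∀ m n → List (Family m n)
  schedules m n = map (fibres ∘ finToFun {m} {n}) (allFin (m ^ n))

  schedule∈schedules : (S : Family m n) → IsSchedule S → S List∈.∈ schedules m n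
  schedule∈schedules {m} {n} S sch =
    subst (List∈._∈ schedules m n)
      (trans (fibres-cong (finToFun-funToFin a)) (schedule≡fibres S sch))
      (∈-map⁺ (fibres ∘ finToFun {m} {n}) (∈-allFin (funToFin a)))
    where a = proj₁ ∘ sch

  schedules-areSchedules : ∀ m n → All.All IsSchedule (schedules m n)
  schedules-areSchedules m n = map⁺ (All.universal (fibres-isSchedule ∘ finToFun {m} {n}) _)
    where open import Data.List.Relation.Unary.All.Properties using (map⁺)

  machine₀ : .{{NonZero m}} → Fin m
  machine₀ {m = suc _} = zero

  minimizer : .{{NonZero m}} → (f : Family m n → Carrier) → ∃ (IsMinimizer f)
  minimizer {m} {n} f =
    E.argmin f S₀ (schedules m n) ,
    E.argmin-all f (fibres-isSchedule λ _ → machine₀) (schedules-areSchedules m n) ,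
    λ S′ sch → All.lookup (E.f[argmin]≤f[xs] {f = f} S₀ (schedules m n))
                          (schedule∈schedules S′ sch)
    where
    module E = Extrema totalOrder
    S₀ : Family m n
    S₀ = fibres λ _ → machine₀

  minimum : .{{NonZero m}} → (Family m n → Carrier) → Carrier
  minimum f = f (proj₁ (minimizer f))

  +-mono-≤ : ∀ {x x′ y y′} → x ≤ x′ → y ≤ y′ → x + y ≤ x′ + y′
  +-mono-≤ {x} {x′} {y} {y′} x≤x′ y≤y′ = O.trans (+-monoˡ-≤ y x≤x′)
    (O.≤-respˡ-≈ (R.+-comm y x′) (O.≤-respʳ-≈ (R.+-comm y′ x′) (+-monoˡ-≤ x′ y≤y′)))

  sum-mono-≤ : ∀ n {f g : Vector Carrier n} → (∀ i → f i ≤ g i) → sum f ≤ sum g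
  sum-mono-≤ 0       _   = O.refl
  sum-mono-≤ (suc n) f≤g = +-mono-≤ (f≤g zero) (sum-mono-≤ n (f≤g ∘ Fin.suc))

  size-mono : {p q : Scenario n} → (∀ j → p j ≤ q j) → ∀ B → size p B ≤ size q B
  size-mono {n} {p} {q} p≤q B = sum-mono-≤ n λ j → go j (lookup B j)
    where
    go : ∀ j b → (if b then p j else 0#) ≤ (if b then q j else 0#)
    go j true  = p≤q j
    go j false = O.refl

  maximum-mono : ∀ m {f g : Fin (suc m) → Carrier} → (∀ i → f i ≤ g i) →
                 maximum (tabulate f) ≤ maximum (tabulate g)
  maximum-mono 0       f≤g = f≤g zero
  maximum-mono (suc m) f≤g = ⊔-mono-≤ (f≤g zero) (maximum-mono m (f≤g ∘ Fin.suc))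

  Cmax-mono : .{{_ : NonZero m}} (S : Family m n) {p q : Scenario n} →
              (∀ j → p j ≤ q j) → Cmax S p ≤ Cmax S q
  Cmax-mono {m = suc m} S p≤q = maximum-mono m λ i → size-mono p≤q (lookup S i)

  OPT : ∀ m → .{{NonZero m}} → Scenario n → Carrier
  OPT m p = minimum {m} λ S → Cmax S p

  module _ (U : UncertaintySet n) where

    open UncertaintySet U

    Makespan : .{{NonZero m}} → Family m n → Pred Carrier 0ℓ
    Makespan S x = ∃ λ p → scenarios p × x ≈ Cmax S p

    worstCase-supremum : .{{_ : NonZero m}} (S : Family m n) →
                         Satisfiable (IsSupremum (Makespan S))
    worstCase-supremum S = complete (Makespan S)
      (Cmax S (proj₁ nonEmpty) , proj₁ nonEmpty , proj₂ nonEmpty , R.refl)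
      (Cmax S (λ _ → proj₁ bounded) ,
       λ { x (p , p∈U , x≈) →
           O.≤-respˡ-≈ (R.sym x≈) (Cmax-mono S (proj₂ bounded p p∈U)) })

    worstCase : .{{NonZero m}} → Family m n → Carrier
    worstCase S = proj₁ (worstCase-supremum S)

    OPTʳᵒᵇ : ∀ m → .{{NonZero m}} → Carrier
    OPTʳᵒᵇ m = minimum {m} worstCase

  -- The shortest prefix ys of xs with θ < w ys, where xs ≡ ys ++ zs.
  record ShortestPrefix (w : List A → Carrier) (θ : Carrier)
                        (xs ys zs : List A) : Set where
    field
      split    : xs ≡ ys ++ zs
      exceeds  : θ < w ys
      shortest : ∀ us v vs → ys ≡ us ++ v ∷ vs → w us ≤ θ

  Block : ℕ → Set
  Block n = List (Fin n)

  jobs : Block n → Subset n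
  jobs B = ⋃ (map ⁅_⁆ B)

  blockSize : Scenario n → Block n → Carrier
  blockSize p B = size p (jobs B)

  totalSize : Scenario n → List (Block n) → Carrier
  totalSize p = foldr (λ B s → blockSize p B + s) 0#

  IsOrderingOf : Subset n → List (Fin n) → Set
  IsOrderingOf B xs = Unique xs × (∀ j → j List∈.∈ xs ⇔ j ∈ B)

  -- Chop p θ R Bs R′: the loop started at R declares the blocks Bs and ends
  -- with the remainder R′.
  data Chop (p : Scenario n) (θ : Carrier) :
            List (Fin n) → List (Block n) → List (Fin n) → Set where
    done : ∀ {R} → ¬ θ < blockSize p R → Chop p θ R [] R
    step : ∀ {R B R₁ Bs R′} → θ < blockSize p R →
           ShortestPrefix (blockSize p) θ R B R₁ →
           Chop p θ R₁ Bs R′ → Chop p θ R (B ∷ Bs) R′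

  -- FirstCrossing p ys Bs As: the machines with the values ys, taken in order,
  -- receive the blocks As when Bs are the blocks not yet assigned. Blocks left
  -- over after the last machine are dropped. In crosses, a machine receives at
  -- least one block, since the ys are nonnegative in the algorithm.
  data FirstCrossing (p : Scenario n) :
                     Vec Carrier m → List (Block n) → Vec (List (Block n)) m → Set where
    end     : ∀ {Bs} → FirstCrossing p [] Bs []
    stop    : {ys : Vec Carrier (suc m)} → FirstCrossing p ys [] (replicate (suc m) [])
    fits    : ∀ {y B Bs} {ys : Vec Carrier m} → totalSize p (B ∷ Bs) ≤ y →
              FirstCrossing p (y ∷ ys) (B ∷ Bs) ((B ∷ Bs) ∷ replicate m [])
    crosses : ∀ {y B Bs Ps Qs As} {ys : Vec Carrier m} → ¬ totalSize p (B ∷ Bs) ≤ y →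
              ShortestPrefix (totalSize p) y (B ∷ Bs) Ps Qs →
              FirstCrossing p ys Qs As →
              FirstCrossing p (y ∷ ys) (B ∷ Bs) (Ps ∷ As)

  -- An execution of the algorithm: a resolution of all its arbitrary choices.
  record BlockPacking (m : ℕ) .{{_ : NonZero m}}
                      (p̂ : Scenario n) (U : UncertaintySet n) (Λ : Carrier) : Set where
    field
      Ŝ T         : Family m n
      Ŝ-minimizes : IsMinimizer (λ S → Cmax S p̂) Ŝ
      T-minimizes : IsMinimizer (worstCase U) T

    Ĥ : Subset n
    Ĥ = tabulate λ j → does ((OPT m p̂ / Λ) <? p̂ j)

    H : Fin m → Subset n
    H i = lookup Ŝ i ∩ Ĥ

    y : Fin m → Carrier
    y i = size p̂ (lookup Ŝ i ─ Ĥ)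

    θ : Carrier
    θ = OPT m p̂ / ((1# + 1#) * Λ)

    field
      R          : Fin m → List (Fin n)
      R-ordering : ∀ i → IsOrderingOf (lookup T i ─ Ĥ) (R i)
      nonTiny    : Fin m → List (Block n)
      -- tiny i is [] if there is no tiny block for i.
      tiny       : Fin m → Block n
      chop       : ∀ i → Chop p̂ θ (R i) (nonTiny i) (tiny i)
      -- The machine receiving tiny i; irrelevant if tiny i is [].
      σ          : Fin m → Fin m
      σ-injects  : ∀ {i i′} → tiny i ≢ [] → tiny i′ ≢ [] → σ i ≡ σ i′ → i ≡ i′
      queue      : List (Block n)
      queue-↭    : queue ↭ concatMap nonTiny (allFin m)
      added      : Vec (List (Block n)) m
      crossing   : FirstCrossing p̂ (tabulate y) queue added

    L : Fin m → Subset n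
    L i = jobs (concatMap tiny (filter (λ k → σ k ≟ i) (allFin m)))
        ∪ jobs (concat (lookup added i))

    output : Family m n
    output = tabulate λ i → H i ∪ L i

-- Put O = OPT p̂ and θ = O / 2Λ, so that heavy jobs are those larger than 2θ.
--
-- Every non-tiny block has predicted size in (θ, 3θ], since it stops at the first job
-- crossing θ. The blocks are disjoint and consist of light jobs, so their total is at
-- most Σ yᵢ and the first-crossing assignment places all of them. A machine receives
-- blocks of total at most yᵢ, one more block and a tiny block, hence a predicted load
-- of at most O + 3θ + θ = (1 + 2/Λ) O.
--
-- In any scenario a job, a block or a tiny block has size at most M = OPTʳᵒᵇ, as it lies
-- in a single part of T. If a machine has h heavy jobs and k blocks besides the last, then
-- θ (2h + k) ≤ O = 2Λθ bounds h + k by 2Λ, so its load is at most (2Λ + 2) M.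
module Submission where

open import Defs
open import Data.Nat.Base using (ℕ; NonZero)
open import Data.Product using (_×_)

open import Algebra.Bundles using (CommutativeMonoid; CommutativeRing)
import Algebra.Construct.NaturalChoice.Max as Max
import Algebra.Properties.CommutativeMonoid.Sum as Sum
import Algebra.Properties.CommutativeSemigroup as CommutativeSemigroupProperties
import Algebra.Solver.Ring.NaturalCoefficients.Default as RingSolver
open import Data.Bool.Base using (true; false; if_then_else_; _∨_)
open import Data.Fin.Base using (Fin; zero; suc)
open import Data.Fin.Properties using (_≟_)
open import Data.Fin.Subset using (Subset; _∈_; _∉_; _⊆_; _∩_; _∪_; _─_; ⊥; ⁅_⁆; ⋃)
open import Data.Fin.Subset.Properties
  using ( _∈?_; ∉⊥; x∈⁅x⁆; x∈⁅y⁆⇒x≡y; p⊆p∪q; q⊆p∪q; x∈p∪q⁻; p∩q⊆p; p∩q⊆q; x∈p∩q⁺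
        ; x∈p∧x∉q⇒x∈p─q; p─q⊆p; drop-there)
open import Data.List.Base as List
  using (List; []; _∷_; _++_; [_]; allFin; concat; concatMap; filter; foldr; map; length
        ; initLast; _∷ʳ′_; fromMaybe)
open import Data.List.Membership.Propositional using () renaming (_∈_ to _∈ˡ_)
open import Data.List.Membership.Propositional.Properties
  using ( ∈-allFin; ∈-filter⁺; ∈-filter⁻; ∈-++⁺ˡ; ∈-++⁺ʳ; ∈-++⁻; ∈-concat⁺′; ∈-concat⁻′
        ; ∈-map⁺; ∈-map⁻; ∈-tabulate⁺)
open import Data.List.Properties using (++-assoc; ++-identityʳ; length-++)
open import Data.List.Relation.Binary.Disjoint.Propositional using (Disjoint)
open import Data.List.Relation.Binary.Disjoint.Propositional.Properties
  using () renaming (sym to Disjoint-sym)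
open import Data.List.Relation.Binary.Permutation.Propositional
  using (↭-refl; ↭-sym; ↭⇒↭ₛ)
open import Data.List.Relation.Binary.Permutation.Propositional.Properties
  using (∈-resp-↭)
import Data.List.Relation.Binary.Permutation.Setoid.Properties as Permₛ
open import Data.List.Relation.Unary.All as All using (All; []; _∷_)
import Data.List.Relation.Unary.All.Properties as All
open import Data.List.Relation.Unary.AllPairs using (AllPairs; []; _∷_)
import Data.List.Relation.Unary.AllPairs.Properties as AllPairs
open import Data.List.Relation.Unary.Any using (here; there)
open import Data.List.Relation.Unary.Unique.Propositional using (Unique)
import Data.List.Relation.Unary.Unique.Propositional.Properties as Unique
open import Data.Maybe.Base using (Maybe; just; nothing)
import Data.Nat.Base as ℕ
import Data.Nat.Properties as ℕ
open import Data.Product using (_,_; ∃; ∃!; ∃₂; proj₁; proj₂)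
open import Data.Sum.Base using (_⊎_; inj₁; inj₂)
open import Data.Vec.Base as Vec using (Vec; []; _∷_; lookup; tabulate; replicate; toList)
open import Data.Vec.Properties using (lookup∘tabulate; []=⇒lookup; lookup⇒[]=; lookup-replicate)
open import Function.Base using (_∘_; id; case_of_)
open import Function.Bundles using (Equivalence; mk⇔)
open import Level using (Level)
open import Relation.Binary.Bundles using (DecTotalOrder)
open import Relation.Binary.Core using (Rel)
import Relation.Binary.Properties.DecTotalOrder as DecTotalOrderProperties
import Relation.Binary.Reasoning.PartialOrder as PartialOrderReasoning
open import Relation.Binary.PropositionalEquality
  using (_≡_; _≢_; refl; sym; trans; cong; subst; setoid; resp₂)
open import Relation.Nullary using (Dec; yes; no; does; ¬_; contradiction)
open import Relation.Nullary.Decidable using (dec-true)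

private variable
  a ℓ : Level
  A   : Set a
  m n : ℕ

-- Lists: pairwise relations, repetition-free lists and concatenation.

module _ {R : Rel A ℓ} where

  AllPairs-++⁻ : ∀ xs {ys} → AllPairs R (xs ++ ys) →
                 AllPairs R xs × AllPairs R ys ×
                 (∀ {x y} → x ∈ˡ xs → y ∈ˡ ys → R x y)
  AllPairs-++⁻ []       rs       = [] , rs , λ ()
  AllPairs-++⁻ (x ∷ xs) (r ∷ rs) =
    let rxs , rys , rxy = AllPairs-++⁻ xs rs in
    All.++⁻ˡ xs r ∷ rxs , rys , λ where
      (here refl) y∈ → All.lookup (All.++⁻ʳ xs r) y∈
      (there x∈)  y∈ → rxy x∈ y∈

Unique-++⁻ : ∀ (xs : List A) {ys} → Unique (xs ++ ys) →
             Unique xs × Unique ys × Disjoint xs ys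
Unique-++⁻ xs u =
  let uxs , uys , x≢y = AllPairs-++⁻ xs u in
  uxs , uys , λ (v∈xs , v∈ys) → x≢y v∈xs v∈ys refl

Unique-concat⁻ : ∀ (xss : List (List A)) → Unique (concat xss) → AllPairs Disjoint xss
Unique-concat⁻ []         _ = []
Unique-concat⁻ (xs ∷ xss) u =
  let _ , u′ , dis = Unique-++⁻ xs u in
  All.tabulate (λ ys∈ (v∈xs , v∈ys) → dis (v∈xs , ∈-concat⁺′ v∈ys ys∈))
    ∷ Unique-concat⁻ xss u′

∈-concat-toList⁺ : (xss : Vec (List A) m) → ∀ {x} i →
                   x ∈ˡ lookup xss i → x ∈ˡ concat (toList xss)
∈-concat-toList⁺ (xs ∷ xss) zero    x∈ = ∈-++⁺ˡ x∈
∈-concat-toList⁺ (xs ∷ xss) (suc i) x∈ = ∈-++⁺ʳ xs (∈-concat-toList⁺ xss i x∈)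

∈-concat-toList⁻ : (xss : Vec (List A) m) → ∀ {x} →
                   x ∈ˡ concat (toList xss) → ∃ λ i → x ∈ˡ lookup xss i
∈-concat-toList⁻ (xs ∷ xss) x∈ with ∈-++⁻ xs x∈
... | inj₁ x∈xs  = zero , x∈xs
... | inj₂ x∈xss = let i , x∈ᵢ = ∈-concat-toList⁻ xss x∈xss in suc i , x∈ᵢ

-- Entries of different lists occupy different positions of the concatenation, so `R` would relate
-- them, in one order or the other; hence the symmetry. With `R` taken as `Disjoint`, this shows
-- that blocks sharing a job are on the same machine.
AllPairs-toList-index :
  {R : Rel A ℓ} → (∀ {x y} → R x y → R y x) →
  (xss : Vec (List A) m) → AllPairs R (concat (toList xss)) →
  ∀ {x y} i j → x ∈ˡ lookup xss i → y ∈ˡ lookup xss j → ¬ R x y → i ≡ j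
AllPairs-toList-index R-sym (xs ∷ xss) rs zero zero x∈ y∈ ¬r = refl
AllPairs-toList-index R-sym (xs ∷ xss) rs zero (suc j) x∈ y∈ ¬r =
  contradiction
    (proj₂ (proj₂ (AllPairs-++⁻ xs rs)) x∈ (∈-concat-toList⁺ xss j y∈)) ¬r
AllPairs-toList-index R-sym (xs ∷ xss) rs (suc i) zero x∈ y∈ ¬r =
  contradiction
    (R-sym (proj₂ (proj₂ (AllPairs-++⁻ xs rs)) y∈ (∈-concat-toList⁺ xss i x∈))) ¬r
AllPairs-toList-index R-sym (xs ∷ xss) rs (suc i) (suc j) x∈ y∈ ¬r =
  cong suc (AllPairs-toList-index R-sym xss (proj₁ (proj₂ (AllPairs-++⁻ xs rs))) i j x∈ y∈ ¬r)

concat-toList-replicate : ∀ m → concat (toList (replicate m ([] {A = A}))) ≡ []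
concat-toList-replicate 0         = refl
concat-toList-replicate (ℕ.suc m) = concat-toList-replicate m

-- The first nonempty `f x` is the whole concatenation: a second one would be the image of the same
-- `x`, which occurs only once. The hypothesis is restricted to nonempty images because `σ` is
-- injective only on machines that have a tiny block.
concatMap-atMostOne : (f : A → List (Fin n)) → ∀ xs → Unique xs →
  (∀ {x y} → x ∈ˡ xs → y ∈ˡ xs → f x ≢ [] → f y ≢ [] → x ≡ y) →
  concatMap f xs ≡ [] ⊎ ∃ λ x → concatMap f xs ≡ f x
concatMap-atMostOne f []       _        _   = inj₁ refl
concatMap-atMostOne f (x ∷ xs) (x∉ ∷ u) one with f x in eq
... | [] = concatMap-atMostOne f xs u λ y∈ z∈ → one (there y∈) (there z∈)
... | v ∷ vs = inj₂ (x , trans (trans (cong ((v ∷ vs) ++_) (rest xs λ y∈ → y∈))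
                                      (++-identityʳ (v ∷ vs))) (sym eq))
  where
  rest : ∀ ys → (∀ {y} → y ∈ˡ ys → y ∈ˡ xs) → concatMap f ys ≡ []
  rest []       _  = refl
  rest (y ∷ ys) ⊆xs with f y in eq′
  ... | [] = rest ys (⊆xs ∘ there)
  ... | w ∷ ws = contradiction
    (one (here refl) (there (⊆xs (here refl)))
      (λ e → case trans (sym eq) e of λ ()) (λ e → case trans (sym eq′) e of λ ()))
    (All.lookup x∉ (⊆xs (here refl)))

-- Membership in unions and differences of subsets.

∈⋃⁺ : ∀ {j : Fin n} {B} {Bs : List (Subset n)} → B ∈ˡ Bs → j ∈ B → j ∈ ⋃ Bs
∈⋃⁺ {Bs = B ∷ Bs} (here refl) j∈ = p⊆p∪q (⋃ Bs) j∈
∈⋃⁺ {Bs = B ∷ Bs} (there B∈)  j∈ = q⊆p∪q B (⋃ Bs) (∈⋃⁺ B∈ j∈)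

∈⋃⁻ : ∀ {j : Fin n} (Bs : List (Subset n)) → j ∈ ⋃ Bs → ∃ λ B → B ∈ˡ Bs × j ∈ B
∈⋃⁻ []       j∈ = contradiction j∈ ∉⊥
∈⋃⁻ (B ∷ Bs) j∈ with x∈p∪q⁻ B (⋃ Bs) j∈
... | inj₁ j∈B = B , here refl , j∈B
... | inj₂ j∈⋃ = let C , C∈ , j∈C = ∈⋃⁻ Bs j∈⋃ in C , there C∈ , j∈C

x∈p─q⇒x∉q : ∀ {x : Fin n} (p q : Subset n) → x ∈ p ─ q → x ∉ q
x∈p─q⇒x∉q (_ ∷ p) (false ∷ q) (Vec.here)     ()
x∈p─q⇒x∉q (_ ∷ p) (_ ∷ q)     (Vec.there x∈) (Vec.there x∈q) = x∈p─q⇒x∉q p q x∈ x∈q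

does-true⁻ : {P : Set ℓ} (P? : Dec P) → does P? ≡ true → P
does-true⁻ (yes p) _  = p
does-true⁻ (no _)  ()

-- Arithmetic in an ordered field.

module OrderedFieldProperties (ℝ : CompleteOrderedField) where

  open CompleteOrderedField ℝ
  open CommutativeRing commutativeRing
    using ( +-identityʳ; +-comm; +-assoc; +-congˡ; *-congˡ; *-congʳ; *-comm; *-assoc
          ; *-identityˡ; zeroʳ; distribˡ; -‿inverseˡ; -‿inverseʳ)
  private module ≤ = DecTotalOrder decTotalOrder
  open DecTotalOrderProperties decTotalOrder using (≰⇒>; ≤⇒≯)
  open PartialOrderReasoning ≤.poset

  +-monoʳ-≤ : ∀ {x y} z → x ≤ y → z + x ≤ z + y
  +-monoʳ-≤ {x} {y} z x≤y = begin
    z + x  ≈⟨ +-comm z x ⟩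
    x + z  ≤⟨ +-monoˡ-≤ z x≤y ⟩
    y + z  ≈⟨ +-comm y z ⟩
    z + y  ∎

  x+z-z≈x : ∀ x z → x + z + - z ≈ x
  x+z-z≈x x z = begin-equality
    x + z + - z    ≈⟨ +-assoc x z (- z) ⟩
    x + (z + - z)  ≈⟨ +-congˡ (-‿inverseʳ z) ⟩
    x + 0#         ≈⟨ +-identityʳ x ⟩
    x              ∎

  +-cancelʳ-≤ : ∀ {x y} z → x + z ≤ y + z → x ≤ y
  +-cancelʳ-≤ {x} {y} z le = begin
    x            ≈⟨ x+z-z≈x x z ⟨
    x + z + - z  ≤⟨ +-monoˡ-≤ (- z) le ⟩
    y + z + - z  ≈⟨ x+z-z≈x y z ⟩
    y            ∎

  x≤x+y : ∀ x {y} → 0# ≤ y → x ≤ x + y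
  x≤x+y x {y} 0≤y = begin
    x       ≈⟨ +-identityʳ x ⟨
    x + 0#  ≤⟨ +-monoʳ-≤ x 0≤y ⟩
    x + y   ∎

  x≤y+x : ∀ x {y} → 0# ≤ y → x ≤ y + x
  x≤y+x x {y} 0≤y = ≤.≤-respʳ-≈ (+-comm x y) (x≤x+y x 0≤y)

  *-monoˡ-≤ : ∀ {c x y} → 0# ≤ c → x ≤ y → c * x ≤ c * y
  *-monoˡ-≤ {c} {x} {y} 0≤c x≤y = begin
    c * x                    ≤⟨ x≤y+x (c * x) (*-nonNegative 0≤c 0≤y-x) ⟩
    c * (y + - x) + c * x    ≈⟨ distribˡ c (y + - x) x ⟨
    c * (y + - x + x)        ≈⟨ *-congˡ (+-assoc y (- x) x) ⟩
    c * (y + (- x + x))      ≈⟨ *-congˡ (+-congˡ (-‿inverseˡ x)) ⟩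
    c * (y + 0#)             ≈⟨ *-congˡ (+-identityʳ y) ⟩
    c * y                    ∎
    where
    0≤y-x : 0# ≤ y + - x
    0≤y-x = ≤.≤-respˡ-≈ (-‿inverseʳ x) (+-monoˡ-≤ (- x) x≤y)

  >⇒≉ : ∀ {c} → 0# < c → ¬ c ≈ 0#
  >⇒≉ (_ , 0≉c) c≈0 = 0≉c (≤.Eq.sym c≈0)

  c*[x/c]≈x : ∀ {c} x → 0# < c → c * (x / c) ≈ x
  c*[x/c]≈x {c} x 0<c = begin-equality
    c * (x * c ⁻¹)  ≈⟨ *-comm c (x * c ⁻¹) ⟩
    x * c ⁻¹ * c    ≈⟨ *-assoc x (c ⁻¹) c ⟩
    x * (c ⁻¹ * c)  ≈⟨ *-congˡ (*-comm (c ⁻¹) c) ⟩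
    x * (c * c ⁻¹)  ≈⟨ *-congˡ (⁻¹-inverseʳ c (>⇒≉ 0<c)) ⟩
    x * 1#          ≈⟨ *-comm x 1# ⟩
    1# * x          ≈⟨ *-identityˡ x ⟩
    x               ∎

  [c*x]/c≈x : ∀ {c} x → 0# < c → (c * x) / c ≈ x
  [c*x]/c≈x {c} x 0<c = ≤.Eq.trans (*-assoc c x (c ⁻¹)) (c*[x/c]≈x x 0<c)

  -- Multiplying by `c ⁻¹` would require its sign, which is not an axiom. Instead, if `x ≤ y`
  -- failed, monotonicity and antisymmetry would make the two products equal, and an equality can be
  -- divided by `c`.
  *-cancelˡ-≤ : ∀ {c x y} → 0# < c → c * x ≤ c * y → x ≤ y
  *-cancelˡ-≤ {c} {x} {y} 0<c cx≤cy with x ≤? y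
  ... | yes x≤y = x≤y
  ... | no  x≰y = contradiction (≤.reflexive x≈y) x≰y
    where
    cx≈cy : c * x ≈ c * y
    cx≈cy = ≤.antisym cx≤cy (*-monoˡ-≤ (proj₁ 0<c) (proj₁ (≰⇒> x≰y)))
    x≈y : x ≈ y
    x≈y = begin-equality
      x            ≈⟨ [c*x]/c≈x x 0<c ⟨
      (c * x) / c  ≈⟨ *-congʳ cx≈cy ⟩
      (c * y) / c  ≈⟨ [c*x]/c≈x y 0<c ⟩
      y            ∎

  0≤x/c : ∀ {c x} → 0# < c → 0# ≤ x → 0# ≤ x / c
  0≤x/c {c} {x} 0<c 0≤x = *-cancelˡ-≤ 0<c (begin
    c * 0#       ≈⟨ zeroʳ c ⟩
    0#           ≤⟨ 0≤x ⟩
    x            ≈⟨ c*[x/c]≈x x 0<c ⟨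
    c * (x / c)  ∎)

  0<x+x : ∀ {x} → 0# < x → 0# < x + x
  0<x+x {x} 0<x@(0≤x , _) = ≤.trans 0≤x (x≤x+y x 0≤x) , λ 0≈x+x →
    ≤⇒≯ (≤.≤-respʳ-≈ (≤.Eq.sym 0≈x+x) (x≤x+y x 0≤x)) 0<x

-- Maxima, and sizes of sets of jobs.

module SchedulingProperties (ℝ : CompleteOrderedField) where

  open CompleteOrderedField ℝ
  open Scheduling ℝ
  open OrderedFieldProperties ℝ
  open CommutativeRing commutativeRing
    using ( +-identityˡ; +-identityʳ; +-comm; +-assoc; +-congˡ; +-congʳ; *-identityʳ; zeroʳ
          ; distribˡ; +-commutativeMonoid)
  private module ≤ = DecTotalOrder decTotalOrder
  open DecTotalOrderProperties decTotalOrder using (≰⇒>; ≮⇒≥; ≤⇒≯)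
  open PartialOrderReasoning ≤.poset hiding (stop)
  open Sum +-commutativeMonoid using (sum)
  open CommutativeSemigroupProperties
    (CommutativeMonoid.commutativeSemigroup +-commutativeMonoid) using (interchange)
  open Max totalOrder using (_⊔_; x≤x⊔y; x≤y⊔x; ⊔-lub)

  maximum-upper : .{{_ : NonZero m}} (f : Fin m → Carrier) → ∀ i → f i ≤ maximum (tabulate f)
  maximum-upper {m = 1}               f zero    = ≤.refl
  maximum-upper {m = ℕ.suc (ℕ.suc m)} f zero    = x≤x⊔y (f zero) _
  maximum-upper {m = ℕ.suc (ℕ.suc m)} f (suc i) =
    ≤.trans (maximum-upper (f ∘ suc) i) (x≤y⊔x (f zero) _)

  maximum-least : .{{_ : NonZero m}} (f : Fin m → Carrier) → ∀ {b} →
                  (∀ i → f i ≤ b) → maximum (tabulate f) ≤ b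
  maximum-least {m = 1}               f f≤b = f≤b zero
  maximum-least {m = ℕ.suc (ℕ.suc m)} f f≤b =
    ⊔-lub (f≤b zero) (maximum-least (f ∘ suc) (f≤b ∘ suc))

  NonNegative : Scenario n → Set
  NonNegative p = ∀ j → 0# ≤ p j

  size-mono-∈ : {p q : Scenario n} (B : Subset n) → (∀ {j} → j ∈ B → p j ≤ q j) →
                size p B ≤ size q B
  size-mono-∈ []          _   = ≤.refl
  size-mono-∈ (true  ∷ B) p≤q = +-mono-≤ (p≤q Vec.here) (size-mono-∈ B (p≤q ∘ Vec.there))
  size-mono-∈ (false ∷ B) p≤q = +-mono-≤ ≤.refl (size-mono-∈ B (p≤q ∘ Vec.there))

  size-mono-⊆ : {p : Scenario n} → NonNegative p → {A B : Subset n} →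
                A ⊆ B → size p A ≤ size p B
  size-mono-⊆ 0≤p {[]}        {[]}        _   = ≤.refl
  size-mono-⊆ 0≤p {true  ∷ A} {true  ∷ B} A⊆B =
    +-mono-≤ ≤.refl (size-mono-⊆ (0≤p ∘ suc) (drop-there ∘ A⊆B ∘ Vec.there))
  size-mono-⊆ 0≤p {true  ∷ A} {false ∷ B} A⊆B = case A⊆B Vec.here of λ ()
  size-mono-⊆ 0≤p {false ∷ A} {true  ∷ B} A⊆B =
    +-mono-≤ (0≤p zero) (size-mono-⊆ (0≤p ∘ suc) (drop-there ∘ A⊆B ∘ Vec.there))
  size-mono-⊆ 0≤p {false ∷ A} {false ∷ B} A⊆B =
    +-mono-≤ ≤.refl (size-mono-⊆ (0≤p ∘ suc) (drop-there ∘ A⊆B ∘ Vec.there))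

  size-⊥ : (p : Scenario n) → size p ⊥ ≈ 0#
  size-⊥ {n = 0}       p = ≤.Eq.refl
  size-⊥ {n = ℕ.suc n} p = ≤.Eq.trans (+-identityˡ _) (size-⊥ (p ∘ suc))

  size-⁅⁆ : (p : Scenario n) → ∀ j → size p ⁅ j ⁆ ≈ p j
  size-⁅⁆ p zero    = ≤.Eq.trans (+-congˡ (size-⊥ (p ∘ suc))) (+-identityʳ (p zero))
  size-⁅⁆ p (suc j) = ≤.Eq.trans (+-identityˡ _) (size-⁅⁆ (p ∘ suc) j)

  size-nonNegative : {p : Scenario n} → NonNegative p → ∀ B → 0# ≤ size p B
  size-nonNegative {p = p} 0≤p B =
    ≤.≤-respˡ-≈ (size-⊥ p) (size-mono-⊆ 0≤p {B = B} λ j∈ → contradiction j∈ ∉⊥)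

  size-∪ : {p : Scenario n} → NonNegative p → (A B : Subset n) →
           size p (A ∪ B) ≤ size p A + size p B
  size-∪ _ [] [] = ≤.reflexive (≤.Eq.sym (+-identityʳ 0#))
  size-∪ {p = p} 0≤p (a ∷ A) (b ∷ B) =
    ≤.trans (+-mono-≤ (head a b) (size-∪ (0≤p ∘ suc) A B))
            (≤.reflexive (interchange _ _ _ _))
    where
    head : ∀ a b → (if a ∨ b then p zero else 0#) ≤
                   (if a then p zero else 0#) + (if b then p zero else 0#)
    head true  true  = x≤x+y (p zero) (0≤p zero)
    head true  false = x≤x+y (p zero) ≤.refl
    head false true  = x≤y+x (p zero) ≤.refl
    head false false = x≤x+y 0# ≤.refl

  size-disjoint : {p : Scenario n} → (A B : Subset n) → (∀ {j} → j ∈ A → j ∉ B) →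
                  size p A + size p B ≤ size p (A ∪ B)
  size-disjoint [] [] _ = ≤.reflexive (+-identityʳ 0#)
  size-disjoint {p = p} (a ∷ A) (b ∷ B) dis =
    ≤.trans (≤.reflexive (interchange _ _ _ _))
            (+-mono-≤ (head a b dis)
                      (size-disjoint A B λ j∈A j∈B → dis (Vec.there j∈A) (Vec.there j∈B)))
    where
    head : ∀ a b → (∀ {j} → j ∈ a ∷ A → j ∉ b ∷ B) →
           (if a then p zero else 0#) + (if b then p zero else 0#) ≤
           (if a ∨ b then p zero else 0#)
    head true  true  dis = contradiction Vec.here (dis Vec.here)
    head true  false _   = ≤.reflexive (+-identityʳ (p zero))
    head false true  _   = ≤.reflexive (+-identityˡ (p zero))
    head false false _   = ≤.reflexive (+-identityʳ 0#)

  size-∩-─ : (p : Scenario n) (A B : Subset n) → size p (A ∩ B) + size p (A ─ B) ≈ size p A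
  size-∩-─ p [] [] = +-identityʳ 0#
  size-∩-─ p (a ∷ A) (b ∷ B) =
    ≤.Eq.trans (interchange _ _ _ _)
      (≤.Eq.trans (+-congʳ (head a b)) (+-congˡ (size-∩-─ (p ∘ suc) A B)))
    where
    head : ∀ a b → (if lookup ((a ∷ A) ∩ (b ∷ B)) zero then p zero else 0#) +
                   (if lookup ((a ∷ A) ─ (b ∷ B)) zero then p zero else 0#) ≈
                   (if a then p zero else 0#)
    head true  true  = +-identityʳ (p zero)
    head true  false = +-identityˡ (p zero)
    head false true  = +-identityʳ 0#
    head false false = +-identityʳ 0#

  -- A union bound: `A` lies in the union of the `f i`, and size is subadditive.
  size-cover : {p : Scenario n} → NonNegative p → (A : Subset n) (f : Fin m → Subset n) →
               (∀ {j} → j ∈ A → ∃ λ i → j ∈ f i) → size p A ≤ sum (λ i → size p (f i))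
  size-cover {p = p} 0≤p A f cover =
    ≤.trans (size-mono-⊆ 0≤p A⊆⋃) (size-⋃ f)
    where
    A⊆⋃ : A ⊆ ⋃ (List.tabulate f)
    A⊆⋃ j∈A = let i , j∈ = cover j∈A in ∈⋃⁺ (∈-tabulate⁺ i) j∈
    size-⋃ : ∀ {k} (g : Fin k → Subset _) →
             size p (⋃ (List.tabulate g)) ≤ sum (λ i → size p (g i))
    size-⋃ {0}       g = ≤.reflexive (size-⊥ p)
    size-⋃ {ℕ.suc k} g = ≤.trans (size-∪ 0≤p (g zero) _) (+-monoʳ-≤ _ (size-⋃ (g ∘ suc)))

  -- Sizes of blocks and of lists of blocks.

  ∈-jobs⁺ : ∀ {j : Fin n} {B} → j ∈ˡ B → j ∈ jobs B
  ∈-jobs⁺ {j = j} j∈ = ∈⋃⁺ (∈-map⁺ ⁅_⁆ j∈) (x∈⁅x⁆ j)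

  ∈-jobs⁻ : ∀ {j : Fin n} B → j ∈ jobs B → j ∈ˡ B
  ∈-jobs⁻ B j∈ with ∈⋃⁻ (map ⁅_⁆ B) j∈
  ... | C , C∈ , j∈C with ∈-map⁻ ⁅_⁆ C∈
  ...   | k , k∈ , refl with x∈⁅y⁆⇒x≡y k j∈C
  ...     | refl = k∈

  blockSize-[] : (p : Scenario n) → blockSize p [] ≈ 0#
  blockSize-[] = size-⊥

  module _ {p : Scenario n} (0≤p : NonNegative p) where

    blockSize-⊆ : ∀ B {C} → (∀ {j} → j ∈ˡ B → j ∈ C) → blockSize p B ≤ size p C
    blockSize-⊆ B ⊆C = size-mono-⊆ 0≤p (⊆C ∘ ∈-jobs⁻ B)

    blockSize-++ : ∀ B C → blockSize p (B ++ C) ≤ blockSize p B + blockSize p C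
    blockSize-++ B C = ≤.trans
      (blockSize-⊆ (B ++ C) λ j∈ → case ∈-++⁻ B j∈ of λ where
        (inj₁ j∈B) → p⊆p∪q (jobs C) (∈-jobs⁺ j∈B)
        (inj₂ j∈C) → q⊆p∪q (jobs B) (jobs C) (∈-jobs⁺ j∈C))
      (size-∪ 0≤p (jobs B) (jobs C))

    blockSize-concat : ∀ Bs → blockSize p (concat Bs) ≤ totalSize p Bs
    blockSize-concat []       = ≤.reflexive (blockSize-[] p)
    blockSize-concat (B ∷ Bs) =
      ≤.trans (blockSize-++ B (concat Bs)) (+-monoʳ-≤ _ (blockSize-concat Bs))

    -- `jobs` is a set and counts each job once, so the sizes add up only as long as no job is
    -- shared between blocks.
    totalSize-disjoint : ∀ Bs → AllPairs Disjoint Bs → totalSize p Bs ≤ blockSize p (concat Bs)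
    totalSize-disjoint []       _            = ≤.reflexive (≤.Eq.sym (blockSize-[] p))
    totalSize-disjoint (B ∷ Bs) (dis ∷ diss) = begin
      blockSize p B + totalSize p Bs           ≤⟨ +-monoʳ-≤ _ (totalSize-disjoint Bs diss) ⟩
      blockSize p B + blockSize p (concat Bs)  ≤⟨ size-disjoint (jobs B) (jobs (concat Bs)) disj ⟩
      size p (jobs B ∪ jobs (concat Bs))       ≤⟨ size-mono-⊆ 0≤p join ⟩
      blockSize p (concat (B ∷ Bs))            ∎
      where
      disj : ∀ {j} → j ∈ jobs B → j ∉ jobs (concat Bs)
      disj j∈B j∈Bs =
        let C , j∈C , C∈ = ∈-concat⁻′ Bs (∈-jobs⁻ (concat Bs) j∈Bs) in
        All.lookup dis C∈ (∈-jobs⁻ B j∈B , j∈C)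
      join : jobs B ∪ jobs (concat Bs) ⊆ jobs (concat (B ∷ Bs))
      join j∈ with x∈p∪q⁻ (jobs B) (jobs (concat Bs)) j∈
      ... | inj₁ j∈B  = ∈-jobs⁺ (∈-++⁺ˡ (∈-jobs⁻ B j∈B))
      ... | inj₂ j∈Bs = ∈-jobs⁺ (∈-++⁺ʳ B (∈-jobs⁻ (concat Bs) j∈Bs))

  totalSize-++ : (p : Scenario n) → ∀ Bs {Cs} →
                 totalSize p (Bs ++ Cs) ≈ totalSize p Bs + totalSize p Cs
  totalSize-++ p []       = ≤.Eq.sym (+-identityˡ _)
  totalSize-++ p (B ∷ Bs) =
    ≤.Eq.trans (+-congˡ (totalSize-++ p Bs)) (≤.Eq.sym (+-assoc _ _ _))

  -- The length as an element of the field, so that it can enter inequalities between sizes.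
  count : List A → Carrier
  count = foldr (λ _ s → 1# + s) 0#

  c*[1+x]≈c+c*x : ∀ c x → c * (1# + x) ≈ c + c * x
  c*[1+x]≈c+c*x c x = ≤.Eq.trans (distribˡ c 1# x) (+-congʳ (*-identityʳ c))

  totalSize-≤ : {p : Scenario n} → ∀ {c Bs} → All (λ B → blockSize p B ≤ c) Bs →
                totalSize p Bs ≤ c * count Bs
  totalSize-≤ []         = ≤.reflexive (≤.Eq.sym (zeroʳ _))
  totalSize-≤ (b≤c ∷ bs) =
    ≤.≤-respʳ-≈ (≤.Eq.sym (c*[1+x]≈c+c*x _ _)) (+-mono-≤ b≤c (totalSize-≤ bs))

  totalSize-≥ : {p : Scenario n} → ∀ {c Bs} → All (λ B → c ≤ blockSize p B) Bs →
                c * count Bs ≤ totalSize p Bs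
  totalSize-≥ []         = ≤.reflexive (zeroʳ _)
  totalSize-≥ (c≤b ∷ bs) =
    ≤.≤-respˡ-≈ (≤.Eq.sym (c*[1+x]≈c+c*x _ _)) (+-mono-≤ c≤b (totalSize-≥ bs))

  -- `size (λ _ → 1#) B` is the cardinality of `B` in the field, the counterpart of `count` for sets
  -- of heavy jobs.
  size-const : ∀ c (B : Subset n) → size (λ _ → c) B ≈ c * size (λ _ → 1#) B
  size-const c []          = ≤.Eq.sym (zeroʳ c)
  size-const c (true  ∷ B) =
    ≤.Eq.trans (+-congˡ (size-const c B))
      (≤.Eq.sym (c*[1+x]≈c+c*x c _))
  size-const c (false ∷ B) =
    ≤.Eq.trans (+-congˡ (size-const c B))
      (≤.Eq.sym (≤.Eq.trans (distribˡ c _ _) (+-congʳ (zeroʳ c))))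

  -- Shortest prefixes and the chopping loop.

  shortestPrefix : (w : List A → Carrier) → ∀ θ xs → θ < w xs →
                   ∃₂ (ShortestPrefix w θ xs)
  shortestPrefix w θ xs θ<w with θ <? w []
  ... | yes θ<w[] = [] , xs , record
    { split = refl ; exceeds = θ<w[]
    ; shortest = λ { [] _ _ () ; (_ ∷ _) _ _ () } }
  shortestPrefix w θ []       θ<w | no θ≮w[] = contradiction θ<w θ≮w[]
  shortestPrefix w θ (x ∷ xs) θ<w | no θ≮w[]
    -- Prefixes are tried in order of length. Moving `x` into the weight function lets the recursion
    -- on the tail still weigh the whole prefix.
    with ys , zs , pre ← shortestPrefix (w ∘ (x ∷_)) θ xs θ<w =
    x ∷ ys , zs , record
      { split    = cong (x ∷_) (ShortestPrefix.split pre)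
      ; exceeds  = ShortestPrefix.exceeds pre
      ; shortest = λ { []       _ _  _    → ≮⇒≥ θ≮w[]
                     ; (u ∷ us) v vs refl → ShortestPrefix.shortest pre us v vs refl }
      }

  -- The last element is the one that crosses `θ`; dropping it brings the weight back to at most
  -- `θ`. The prefix can be empty only if already `θ < w []`.
  shortestPrefix-view : ∀ {w : List A → Carrier} {θ xs ys zs} → ShortestPrefix w θ xs ys zs →
                        ys ≡ [] ⊎ ∃₂ λ us v → ys ≡ us ++ [ v ] × w us ≤ θ
  shortestPrefix-view {ys = ys} pre with initLast ys
  ... | []       = inj₁ refl
  ... | us ∷ʳ′ v = inj₂ (us , v , refl , ShortestPrefix.shortest pre us v [] refl)

  module _ {p : Scenario n} {θ} (0≤θ : 0# ≤ θ) where

    exceeds⇒nonempty : ∀ {B} → θ < blockSize p B → B ≢ []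
    exceeds⇒nonempty θ<B refl = ≤⇒≯ (≤.≤-respˡ-≈ (≤.Eq.sym (blockSize-[] p)) 0≤θ) θ<B

    -- The loop terminates: as `θ` is nonnegative, each block is nonempty and the remainder gets
    -- shorter. The bound `k` on its length serves as the recursion argument.
    chop-exists : ∀ k R → length R ℕ.≤ k → ∃₂ (Chop p θ R)
    chop-exists k R ∣R∣≤k with θ <? blockSize p R
    ... | no  θ≮R = [] , R , done θ≮R
    ... | yes θ<R with shortestPrefix (blockSize p) θ R θ<R
    ...   | [] , _ , pre = contradiction refl (exceeds⇒nonempty (ShortestPrefix.exceeds pre))
    ...   | B@(_ ∷ B′) , R₁ , pre with ShortestPrefix.split pre | k | ∣R∣≤k
    ...     | refl | ℕ.suc k | ℕ.s≤s ∣B′++R₁∣≤k =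
      let Bs , R′ , c = chop-exists k R₁ (ℕ.≤-trans ∣R₁∣≤ ∣B′++R₁∣≤k)
      in B ∷ Bs , R′ , step θ<R pre c
      where
      ∣R₁∣≤ : length R₁ ℕ.≤ length (B′ ++ R₁)
      ∣R₁∣≤ = ℕ.≤-trans (ℕ.m≤n+m (length R₁) (length B′)) (ℕ.≤-reflexive (sym (length-++ B′)))

  chop-split : ∀ {p : Scenario n} {θ R Bs R′} → Chop p θ R Bs R′ → R ≡ concat Bs ++ R′
  chop-split (done _)       = refl
  chop-split (step {B = B} {Bs = Bs} {R′ = R′} _ pre c) =
    trans (ShortestPrefix.split pre)
      (trans (cong (B ++_) (chop-split c)) (sym (++-assoc B (concat Bs) R′)))

  chop-remainder-≤ : ∀ {p : Scenario n} {θ R Bs R′} → Chop p θ R Bs R′ → blockSize p R′ ≤ θ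
  chop-remainder-≤ (done θ≮R)   = ≮⇒≥ θ≮R
  chop-remainder-≤ (step _ _ c) = chop-remainder-≤ c

  chop-blocks-> : ∀ {p : Scenario n} {θ R Bs R′} → Chop p θ R Bs R′ →
                  All (λ B → θ < blockSize p B) Bs
  chop-blocks-> (done _)       = []
  chop-blocks-> (step _ pre c) = ShortestPrefix.exceeds pre ∷ chop-blocks-> c

  -- Without its last job a block is a prefix of size at most `θ`, and the last job adds at most
  -- `c`.
  chop-blocks-≤ : ∀ {p : Scenario n} {θ c R Bs R′} → NonNegative p → 0# ≤ θ →
                  (∀ {j} → j ∈ˡ R → p j ≤ c) → Chop p θ R Bs R′ →
                  All (λ B → blockSize p B ≤ θ + c) Bs
  chop-blocks-≤ 0≤p 0≤θ p≤c (done _) = []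
  chop-blocks-≤ {p = p} {θ} {c} {R} 0≤p 0≤θ p≤c (step {B = B} {R₁} _ pre ch) =
    block≤ ∷ chop-blocks-≤ 0≤p 0≤θ (λ j∈ → p≤c (subst (_ ∈ˡ_) (sym split) (∈-++⁺ʳ B j∈))) ch
    where
    open ShortestPrefix pre
    block≤ : blockSize p B ≤ θ + c
    block≤ with shortestPrefix-view pre
    ... | inj₁ B≡[] = contradiction B≡[] (exceeds⇒nonempty 0≤θ exceeds)
    ... | inj₂ (us , v , refl , us≤θ) = begin
      blockSize p (us ++ [ v ])          ≤⟨ blockSize-++ 0≤p us [ v ] ⟩
      blockSize p us + blockSize p [ v ] ≤⟨ +-mono-≤ us≤θ v≤c ⟩
      θ + c                              ∎
      where
      v≤c : blockSize p [ v ] ≤ c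
      v≤c = begin
        blockSize p [ v ]             ≤⟨ size-∪ 0≤p ⁅ v ⁆ ⊥ ⟩
        size p ⁅ v ⁆ + size p ⊥       ≈⟨ ≤.Eq.trans (+-congˡ (size-⊥ p)) (+-identityʳ _) ⟩
        size p ⁅ v ⁆                  ≈⟨ size-⁅⁆ p v ⟩
        p v                           ≤⟨ p≤c (subst (v ∈ˡ_) (sym split)
                                             (∈-++⁺ˡ (∈-++⁺ʳ us (here refl)))) ⟩
        c                             ∎

  -- The first-crossing assignment.

  firstCrossing-exists : (p : Scenario n) (ys : Vec Carrier m) → ∀ Bs → ∃ (FirstCrossing p ys Bs)
  firstCrossing-exists p []       Bs = [] , end
  firstCrossing-exists p (y ∷ ys) [] = _ , stop {ys = y ∷ ys}
  firstCrossing-exists p (y ∷ ys) (B ∷ Bs) with totalSize p (B ∷ Bs) ≤? y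
  ... | yes le = _ , fits le
  ... | no ¬le =
    let Ps , Qs , pre = shortestPrefix (totalSize p) y (B ∷ Bs) (≰⇒> ¬le)
        As , fc       = firstCrossing-exists p ys Qs
    in Ps ∷ As , crosses ¬le pre fc

  -- A machine that is crossed receives more than its share of the total of ys,
  -- so the remaining machines keep enough room for the remaining blocks.
  firstCrossing-complete : ∀ {p : Scenario n} {ys : Vec Carrier m} {Bs As} →
    FirstCrossing p ys Bs As → All (λ B → 0# < blockSize p B) Bs →
    totalSize p Bs ≤ sum (lookup ys) → concat (toList As) ≡ Bs
  firstCrossing-complete {Bs = []} end _ _ = refl
  firstCrossing-complete {p = p} {Bs = B ∷ Bs} end (0<B ∷ 0<Bs) le =
    contradiction 0<B (≤⇒≯ (≤.trans (x≤x+y _ (0≤total 0<Bs)) le))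
    where
    0≤total : ∀ {Cs} → All (λ C → 0# < blockSize p C) Cs → 0# ≤ totalSize p Cs
    0≤total []           = ≤.refl
    0≤total (0<C ∷ 0<Cs) = ≤.trans (proj₁ 0<C) (x≤x+y _ (0≤total 0<Cs))
  firstCrossing-complete (stop {m = m}) _ _ = concat-toList-replicate m
  firstCrossing-complete (fits {m = m} {B = B} {Bs} _) _ _ =
    trans (cong ((B ∷ Bs) ++_) (concat-toList-replicate m)) (++-identityʳ _)
  firstCrossing-complete {p = p}
    (crosses {y = y} {B} {Bs} {Ps} {Qs} {ys = ys} _ pre fc) 0<Bs le =
    trans (cong (Ps ++_) (firstCrossing-complete fc 0<Qs Qs≤)) (sym split)
    where
    open ShortestPrefix pre
    0<Qs = All.++⁻ʳ Ps (subst (All _) split 0<Bs)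
    Qs≤ : totalSize p Qs ≤ sum (lookup ys)
    Qs≤ = +-cancelʳ-≤ y (begin
      totalSize p Qs + y                  ≤⟨ +-monoʳ-≤ _ (proj₁ exceeds) ⟩
      totalSize p Qs + totalSize p Ps     ≈⟨ +-comm _ _ ⟩
      totalSize p Ps + totalSize p Qs     ≈⟨ totalSize-++ p Ps ⟨
      totalSize p (Ps ++ Qs)              ≡⟨ cong (totalSize p) split ⟨
      totalSize p (B ∷ Bs)                ≤⟨ le ⟩
      y + sum (lookup ys)                 ≈⟨ +-comm y _ ⟩
      sum (lookup ys) + y                 ∎)

  -- On a crossed machine `V` is the block that crosses, and minimality of the prefix makes the
  -- earlier ones fit. On every other machine all blocks fit, trivially so when there are none,
  -- since the values `ys` are nonnegative.
  firstCrossing-load : ∀ {p : Scenario n} {ys : Vec Carrier m} {Bs As} →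
    FirstCrossing p ys Bs As → (∀ i → 0# ≤ lookup ys i) → ∀ i →
    ∃₂ λ Us (V : Maybe (Block n)) →
      lookup As i ≡ Us ++ fromMaybe V × totalSize p Us ≤ lookup ys i
  firstCrossing-load (stop {m = m}) 0≤ys i =
    [] , nothing , lookup-replicate i [] , 0≤ys i
  firstCrossing-load (fits le) 0≤ys zero =
    _ , nothing , sym (++-identityʳ _) , le
  firstCrossing-load (fits _) 0≤ys (suc i) =
    [] , nothing , lookup-replicate i [] , 0≤ys (suc i)
  firstCrossing-load (crosses _ pre fc) 0≤ys zero with shortestPrefix-view pre
  -- An empty prefix exceeding `y` would mean that `y` is negative; the trivial decomposition
  -- settles the case without deriving the contradiction.
  ... | inj₁ Ps≡[]                  = [] , nothing , Ps≡[] , 0≤ys zero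
  ... | inj₂ (Us , V , Ps≡ , Us≤y) = Us , just V , Ps≡ , Us≤y
  firstCrossing-load (crosses _ _ fc) 0≤ys (suc i) = firstCrossing-load fc (0≤ys ∘ suc) i

-- Optimal values and the existence of a run.

module BlockPackingProperties (ℝ : CompleteOrderedField) where

  open CompleteOrderedField ℝ
  open Scheduling ℝ
  open OrderedFieldProperties ℝ
  open SchedulingProperties ℝ
  open CommutativeRing commutativeRing
    using ( +-identityʳ; +-cong; +-congˡ; *-congʳ; *-comm; *-identityˡ; zeroˡ; zeroʳ
          ; distribʳ; +-commutativeMonoid; commutativeSemiring)
  private module ≤ = DecTotalOrder decTotalOrder
  open DecTotalOrderProperties decTotalOrder using (≰⇒>; ≮⇒≥; ≤⇒≯; <-respʳ-≈)
  open PartialOrderReasoning ≤.poset hiding (stop)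
  open Sum +-commutativeMonoid using (sum; sum-cong-≗)
  open RingSolver commutativeSemiring using (solve; _:+_; _:*_; _:=_)

  private
    2# 4# : Carrier
    2# = 1# + 1#
    4# = 2# + 2#

  2#*x≈x+x : ∀ x → 2# * x ≈ x + x
  2#*x≈x+x x = ≤.Eq.trans (distribʳ x 1# 1#) (+-cong (*-identityˡ x) (*-identityˡ x))

  4#*x≈x+x+[x+x] : ∀ x → 4# * x ≈ (x + x) + (x + x)
  4#*x≈x+x+[x+x] x = ≤.Eq.trans (distribʳ x 2# 2#) (+-cong (2#*x≈x+x x) (2#*x≈x+x x))

  -- A run may choose any minimizer, whereas `minimum` is the value at the particular one given by
  -- `minimizer`.
  minimizer-≤-minimum : .{{_ : NonZero m}} (f : Family m n → Carrier) (S : Family m n) →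
                        IsMinimizer f S → f S ≤ minimum f
  minimizer-≤-minimum f S (_ , f[S]≤) =
    f[S]≤ (proj₁ (minimizer f)) (proj₁ (proj₂ (minimizer f)))

  size-≤-Cmax : .{{_ : NonZero m}} (S : Family m n) (p : Scenario n) → ∀ i →
                size p (lookup S i) ≤ Cmax S p
  size-≤-Cmax S p = maximum-upper λ i → size p (lookup S i)

  0≤OPT : .{{_ : NonZero m}} {p : Scenario n} → NonNegative p → 0# ≤ OPT m p
  0≤OPT {m = m} {p = p} 0≤p =
    ≤.trans (size-nonNegative 0≤p (lookup S machine₀)) (size-≤-Cmax S p machine₀)
    where S = proj₁ (minimizer {m} λ S → Cmax S p)

  totalSize-fromMaybe : {p : Scenario n} → ∀ {c} → 0# ≤ c → (V : Maybe (Block n)) →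
                        All (λ B → blockSize p B ≤ c) (fromMaybe V) →
                        totalSize p (fromMaybe V) ≤ c
  totalSize-fromMaybe 0≤c nothing  _         = 0≤c
  totalSize-fromMaybe 0≤c (just V) (V≤c ∷ _) = ≤.≤-respˡ-≈ (≤.Eq.sym (+-identityʳ _)) V≤c

  module _ {Λ} (0<Λ : 0# < Λ) {m n} .{{_ : NonZero m}}
           {U : UncertaintySet n} {p̂ : Scenario n}
           (p̂∈U : UncertaintySet.scenarios U p̂) where

    open UncertaintySet U

    0≤p̂ : NonNegative p̂
    0≤p̂ = nonNegative p̂ p̂∈U

    0<2Λ : 0# < 2# * Λ
    0<2Λ = <-respʳ-≈ (≤.Eq.sym (2#*x≈x+x Λ)) (0<x+x 0<Λ)

    0≤O/2Λ : 0# ≤ OPT m p̂ / (2# * Λ)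
    0≤O/2Λ = 0≤x/c 0<2Λ (0≤OPT 0≤p̂)

    -- Guards against vacuity of the bounds, which hold for every run. The arbitrary choices are
    -- resolved canonically: jobs in increasing order, each tiny block on the machine of its own
    -- index, the queue left unshuffled.
    run-exists : BlockPacking m p̂ U Λ
    run-exists = record
      { Ŝ           = proj₁ Ŝ-min
      ; T           = T
      ; Ŝ-minimizes = proj₂ Ŝ-min
      ; T-minimizes = proj₂ T-min
      ; R           = R
      ; R-ordering  = λ i → Unique.filter⁺ (_∈? (lookup T i ─ Ĥ)) (Unique.allFin⁺ n) ,
          λ j → mk⇔ (proj₂ ∘ ∈-filter⁻ (_∈? (lookup T i ─ Ĥ)) {xs = allFin n})
                    (∈-filter⁺ (_∈? (lookup T i ─ Ĥ)) (∈-allFin j))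
      ; nonTiny     = λ i → proj₁ (chopped i)
      ; tiny        = λ i → proj₁ (proj₂ (chopped i))
      ; chop        = λ i → proj₂ (proj₂ (chopped i))
      ; σ           = id
      ; σ-injects   = λ _ _ → id
      ; queue       = queue
      ; queue-↭     = ↭-refl
      ; added       = proj₁ crossed
      ; crossing    = proj₂ crossed
      }
      where
      Ŝ-min = minimizer {m} λ S → Cmax S p̂
      T-min = minimizer {m} (worstCase U)
      T = proj₁ T-min
      Ĥ : Subset n
      Ĥ = tabulate λ j → does ((OPT m p̂ / Λ) <? p̂ j)
      R : Fin m → List (Fin n)
      R i = filter (_∈? (lookup T i ─ Ĥ)) (allFin n)
      chopped : ∀ i → ∃₂ (Chop p̂ (OPT m p̂ / (2# * Λ)) (R i))
      chopped i = chop-exists 0≤O/2Λ (length (R i)) (R i) ℕ.≤-refl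
      queue = concatMap (proj₁ ∘ chopped) (allFin m)
      crossed = firstCrossing-exists p̂ (tabulate λ i → size p̂ (lookup (proj₁ Ŝ-min) i ─ Ĥ)) queue

    -- Bounds that a fixed run inherits from its two optimal schedules.

    module _ (run : BlockPacking m p̂ U Λ) where

      open BlockPacking run

      O M : Carrier
      O = OPT m p̂
      M = OPTʳᵒᵇ U m

      Ŝ-load : ∀ i → size p̂ (lookup Ŝ i) ≤ O
      Ŝ-load i = ≤.trans (size-≤-Cmax Ŝ p̂ i)
        (minimizer-≤-minimum (λ S → Cmax S p̂) Ŝ Ŝ-minimizes)

      T-load : ∀ {p} → scenarios p → ∀ k → size p (lookup T k) ≤ M
      T-load {p} p∈U k = begin
        size p (lookup T k)  ≤⟨ size-≤-Cmax T p k ⟩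
        Cmax T p             ≤⟨ proj₁ (proj₂ (worstCase-supremum U T)) _ (p , p∈U , ≤.Eq.refl) ⟩
        worstCase U T        ≤⟨ minimizer-≤-minimum (worstCase U) T T-minimizes ⟩
        M                    ∎

      0≤M : 0# ≤ M
      0≤M = ≤.trans (size-nonNegative 0≤p̂ (lookup T machine₀)) (T-load p̂∈U machine₀)

      -- The machine that runs the job carries at least its size. Used with `T` to bound jobs by `M`
      -- in any scenario, and with `Ŝ` to bound predicted jobs by `O`.
      job-≤ : ∀ {p : Scenario n} {c} (S : Family m n) → NonNegative p → IsSchedule S →
              (∀ i → size p (lookup S i) ≤ c) → ∀ j → p j ≤ c
      job-≤ {p} {c} S 0≤p sch load j = let i , j∈ , _ = sch j in begin
        p j                  ≈⟨ size-⁅⁆ p j ⟨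
        size p ⁅ j ⁆         ≤⟨ size-mono-⊆ 0≤p (λ k∈ →
                                  subst (_∈ lookup S i) (sym (x∈⁅y⁆⇒x≡y j k∈)) j∈) ⟩
        size p (lookup S i)  ≤⟨ load i ⟩
        c                    ∎

      2Λθ≈O : (2# * Λ) * θ ≈ O
      2Λθ≈O = c*[x/c]≈x O 0<2Λ

      -- Expresses the threshold for heavy jobs in the unit `θ` that also measures the blocks.
      O/Λ≈θ+θ : O / Λ ≈ θ + θ
      O/Λ≈θ+θ = begin-equality
        O / Λ              ≈⟨ *-congʳ 2Λθ≈O ⟨
        (2# * Λ) * θ / Λ   ≈⟨ *-congʳ (*-congʳ (2#*x≈x+x Λ)) ⟩
        (Λ + Λ) * θ / Λ    ≈⟨ *-congʳ (solve 2 (λ Λ θ → (Λ :+ Λ) :* θ := Λ :* (θ :+ θ))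
                                        ≤.Eq.refl Λ θ) ⟩
        Λ * (θ + θ) / Λ    ≈⟨ [c*x]/c≈x (θ + θ) 0<Λ ⟩
        θ + θ              ∎

      lookup-Ĥ : ∀ j → lookup Ĥ j ≡ does ((O / Λ) <? p̂ j)
      lookup-Ĥ = lookup∘tabulate λ j → does ((O / Λ) <? p̂ j)

      ∈Ĥ⇒> : ∀ {j} → j ∈ Ĥ → O / Λ < p̂ j
      ∈Ĥ⇒> {j} j∈ =
        does-true⁻ ((O / Λ) <? p̂ j) (trans (sym (lookup-Ĥ j)) ([]=⇒lookup j∈))

      ∉Ĥ⇒≤ : ∀ {j} → j ∉ Ĥ → p̂ j ≤ θ + θ
      ∉Ĥ⇒≤ {j} j∉ = ≤.≤-respʳ-≈ O/Λ≈θ+θ (≮⇒≥ λ lt →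
        j∉ (lookup⇒[]= j Ĥ (trans (lookup-Ĥ j) (dec-true ((O / Λ) <? p̂ j) lt))))

      -- Origin, disjointness and sizes of the blocks.

      R⇒T : ∀ {j k} → j ∈ˡ R k → j ∈ lookup T k
      R⇒T {j} {k} j∈ = p─q⊆p (lookup T k) Ĥ (Equivalence.to (proj₂ (R-ordering k) j) j∈)

      R⇒∉Ĥ : ∀ {j k} → j ∈ˡ R k → j ∉ Ĥ
      R⇒∉Ĥ {j} {k} j∈ =
        x∈p─q⇒x∉q (lookup T k) Ĥ (Equivalence.to (proj₂ (R-ordering k) j) j∈)

      R-owner : ∀ {j k k′} → j ∈ˡ R k → j ∈ˡ R k′ → k ≡ k′
      R-owner {j} j∈k j∈k′ = let _ , _ , unique = proj₁ T-minimizes j in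
        trans (sym (unique (R⇒T j∈k))) (unique (R⇒T j∈k′))

      R-split : ∀ k → R k ≡ concat (nonTiny k) ++ tiny k
      R-split k = chop-split (chop k)

      nonTiny⇒R : ∀ {j k B} → B ∈ˡ nonTiny k → j ∈ˡ B → j ∈ˡ R k
      nonTiny⇒R {j} {k} B∈ j∈ =
        subst (j ∈ˡ_) (sym (R-split k)) (∈-++⁺ˡ (∈-concat⁺′ j∈ B∈))

      tiny⇒R : ∀ {j k} → j ∈ˡ tiny k → j ∈ˡ R k
      tiny⇒R {j} {k} j∈ =
        subst (j ∈ˡ_) (sym (R-split k)) (∈-++⁺ʳ (concat (nonTiny k)) j∈)

      R-unique : ∀ k → Unique (concat (nonTiny k) ++ tiny k)
      R-unique k = subst Unique (R-split k) (proj₁ (R-ordering k))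

      queue⁻ : ∀ {B} → B ∈ˡ queue → ∃ λ k → B ∈ˡ nonTiny k
      queue⁻ B∈
        with Bs , B∈Bs , Bs∈ ← ∈-concat⁻′ (map nonTiny (allFin m)) (∈-resp-↭ queue-↭ B∈)
        with k , _ , refl ← ∈-map⁻ nonTiny Bs∈ = k , B∈Bs

      queue⁺ : ∀ {k B} → B ∈ˡ nonTiny k → B ∈ˡ queue
      queue⁺ {k} B∈ =
        ∈-resp-↭ (↭-sym queue-↭) (∈-concat⁺′ B∈ (∈-map⁺ nonTiny (∈-allFin k)))

      queue-all : ∀ {P : Block n → Set} → (∀ k → All P (nonTiny k)) → All P queue
      queue-all all = All.tabulate λ B∈ → let k , B∈k = queue⁻ B∈ in All.lookup (all k) B∈k

      -- Blocks cut from one part of `T` are disjoint because `R k` has no repetitions, blocks from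
      -- different parts by `R-owner`. Disjointness is symmetric, so it survives the reordering into
      -- `queue`.
      queue-disjoint : AllPairs Disjoint queue
      queue-disjoint = Permₛ.AllPairs-resp-↭ (setoid _) {R = Disjoint}
        Disjoint-sym (resp₂ Disjoint) (↭⇒↭ₛ (↭-sym queue-↭))
        (AllPairs.concat⁺
          (All.map⁺ (All.tabulate λ {k} _ →
            Unique-concat⁻ (nonTiny k) (proj₁ (Unique-++⁻ (concat (nonTiny k)) (R-unique k)))))
          (AllPairs.map⁺ (AllPairs.tabulate⁺ λ k≢k′ →
            All.tabulate λ B∈ → All.tabulate λ B′∈ (j∈B , j∈B′) →
              k≢k′ (R-owner (nonTiny⇒R B∈ j∈B) (nonTiny⇒R B′∈ j∈B′)))))

      queue-θ< : All (λ B → θ < blockSize p̂ B) queue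
      queue-θ< = queue-all λ k → chop-blocks-> (chop k)

      queue-≤3θ : All (λ B → blockSize p̂ B ≤ θ + (θ + θ)) queue
      queue-≤3θ = queue-all λ k → chop-blocks-≤ 0≤p̂ 0≤O/2Λ (∉Ĥ⇒≤ ∘ R⇒∉Ĥ) (chop k)

      queue-≤M : ∀ {p} → scenarios p → All (λ B → blockSize p B ≤ M) queue
      queue-≤M {p} p∈U = queue-all λ k → All.tabulate λ {B} B∈ →
        ≤.trans (blockSize-⊆ (nonNegative p p∈U) B (R⇒T ∘ nonTiny⇒R B∈)) (T-load p∈U k)

      queue-fits : totalSize p̂ queue ≤ sum (lookup (tabulate y))
      queue-fits = begin
        totalSize p̂ queue           ≤⟨ totalSize-disjoint 0≤p̂ queue queue-disjoint ⟩
        blockSize p̂ (concat queue)  ≤⟨ size-cover 0≤p̂ _ (λ i → lookup Ŝ i ─ Ĥ) cover ⟩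
        sum y                       ≡⟨ sum-cong-≗ (lookup∘tabulate y) ⟨
        sum (lookup (tabulate y))   ∎
        where
        cover : ∀ {j} → j ∈ jobs (concat queue) → ∃ λ i → j ∈ lookup Ŝ i ─ Ĥ
        cover {j} j∈ =
          let B , j∈B , B∈ = ∈-concat⁻′ queue (∈-jobs⁻ (concat queue) j∈)
              k , B∈k      = queue⁻ B∈
              i , j∈i , _  = proj₁ Ŝ-minimizes j
          in i , x∈p∧x∉q⇒x∈p─q j∈i (R⇒∉Ĥ (nonTiny⇒R B∈k j∈B))

      -- `FirstCrossing` would drop blocks left over after the last machine. None are left, because
      -- every block has positive predicted size and the `y i` together have room for all of them.
      added-complete : concat (toList added) ≡ queue
      added-complete = firstCrossing-complete crossing
        (All.map (λ θ<B → ≤.trans 0≤O/2Λ (proj₁ θ<B) ,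
                          λ 0≈B → ≤⇒≯ (≤.≤-respˡ-≈ 0≈B 0≤O/2Λ) θ<B) queue-θ<)
        queue-fits

      added⇒queue : ∀ {B} i → B ∈ˡ lookup added i → B ∈ˡ queue
      added⇒queue i B∈ = subst (_ ∈ˡ_) added-complete (∈-concat-toList⁺ added i B∈)

      -- The output is a schedule.

      tinyJobs : Fin m → Block n
      tinyJobs i = concatMap tiny (filter (λ k → σ k ≟ i) (allFin m))

      ∈-tinyJobs⁺ : ∀ {j k} → j ∈ˡ tiny k → j ∈ˡ tinyJobs (σ k)
      ∈-tinyJobs⁺ {k = k} j∈ = ∈-concat⁺′ j∈
        (∈-map⁺ tiny (∈-filter⁺ (λ k′ → σ k′ ≟ σ k) (∈-allFin k) refl))

      ∈-tinyJobs⁻ : ∀ {j i} → j ∈ˡ tinyJobs i → ∃ λ k → σ k ≡ i × j ∈ˡ tiny k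
      ∈-tinyJobs⁻ {i = i} j∈
        with B , j∈B , B∈ ← ∈-concat⁻′ (map tiny (filter (λ k → σ k ≟ i) (allFin m))) j∈
        with k , k∈ , refl ← ∈-map⁻ tiny B∈ =
        k , proj₂ (∈-filter⁻ (λ k → σ k ≟ i) {xs = allFin m} k∈) , j∈B

      ∈-L⁻ : ∀ {j i} → j ∈ L i →
             (∃ λ k → σ k ≡ i × j ∈ˡ tiny k) ⊎ (∃ λ B → j ∈ˡ B × B ∈ˡ lookup added i)
      ∈-L⁻ {j} {i} j∈ with x∈p∪q⁻ (jobs (tinyJobs i)) (jobs (concat (lookup added i))) j∈
      ... | inj₁ j∈tiny  = inj₁ (∈-tinyJobs⁻ (∈-jobs⁻ (tinyJobs i) j∈tiny))
      ... | inj₂ j∈added = inj₂ (∈-concat⁻′ (lookup added i) (∈-jobs⁻ _ j∈added))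

      L⇒∉Ĥ : ∀ {j} i → j ∈ L i → j ∉ Ĥ
      L⇒∉Ĥ i j∈ with ∈-L⁻ {i = i} j∈
      ... | inj₁ (k , _ , j∈tiny) = R⇒∉Ĥ (tiny⇒R j∈tiny)
      ... | inj₂ (B , j∈B , B∈)   = R⇒∉Ĥ (nonTiny⇒R (proj₂ (queue⁻ (added⇒queue i B∈))) j∈B)

      -- A common job forces both blocks to come from the same part of `T`, whose ordering would
      -- then repeat that job.
      tiny-nonTiny-disjoint : ∀ {j k k′ B} → j ∈ˡ tiny k → j ∈ˡ B → ¬ B ∈ˡ nonTiny k′
      tiny-nonTiny-disjoint {k = k} j∈tiny j∈B B∈
        with refl ← R-owner (tiny⇒R j∈tiny) (nonTiny⇒R B∈ j∈B) =
        proj₂ (proj₂ (Unique-++⁻ (concat (nonTiny k)) (R-unique k)))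
          (∈-concat⁺′ j∈B B∈ , j∈tiny)

      lookup-output : ∀ i → lookup output i ≡ H i ∪ L i
      lookup-output = lookup∘tabulate λ i → H i ∪ L i

      heavy-assigned : ∀ {j} → j ∈ Ĥ → ∃! _≡_ λ i → j ∈ H i ∪ L i
      heavy-assigned {j} j∈Ĥ = let i , j∈i , unique = proj₁ Ŝ-minimizes j in
        i , p⊆p∪q (L i) (x∈p∩q⁺ (j∈i , j∈Ĥ)) , λ {i′} j∈ → case x∈p∪q⁻ (H i′) (L i′) j∈ of λ where
          (inj₁ j∈H) → unique (p∩q⊆p (lookup Ŝ i′) Ĥ j∈H)
          (inj₂ j∈L) → contradiction j∈Ĥ (L⇒∉Ĥ i′ j∈L)

      -- The part of `T` with index `k` containing the job was cut into non-tiny blocks and a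
      -- remainder, one of which holds it. The remainder goes to `σ k` alone. A non-tiny block is
      -- placed by `added-complete`, and no other machine has a block with this job, since placed
      -- blocks are pairwise disjoint.
      light-assigned : ∀ {j} → j ∉ Ĥ → ∃! _≡_ λ i → j ∈ L i
      light-assigned {j} j∉Ĥ
        with k , j∈k , _ ← proj₁ T-minimizes j
        with ∈-++⁻ (concat (nonTiny k)) (subst (j ∈ˡ_) (R-split k)
               (Equivalence.from (proj₂ (R-ordering k) j) (x∈p∧x∉q⇒x∈p─q j∈k j∉Ĥ)))
      ... | inj₂ j∈tiny =
        σ k , p⊆p∪q _ (∈-jobs⁺ (∈-tinyJobs⁺ j∈tiny)) , λ {i′} j∈ → case ∈-L⁻ {i = i′} j∈ of λ where
          (inj₁ (k′ , refl , j∈tiny′)) → cong σ (R-owner (tiny⇒R j∈tiny) (tiny⇒R j∈tiny′))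
          (inj₂ (B , j∈B , B∈)) →
            contradiction (proj₂ (queue⁻ (added⇒queue i′ B∈))) (tiny-nonTiny-disjoint j∈tiny j∈B)
      ... | inj₁ j∈concat
        with B , j∈B , B∈ ← ∈-concat⁻′ (nonTiny k) j∈concat
        with i , B∈i ← ∈-concat-toList⁻ added (subst (B ∈ˡ_) (sym added-complete) (queue⁺ B∈)) =
        i , q⊆p∪q (jobs (tinyJobs i)) _ (∈-jobs⁺ (∈-concat⁺′ j∈B B∈i)) ,
        λ {i′} j∈ → case ∈-L⁻ {i = i′} j∈ of λ where
          (inj₁ (k′ , _ , j∈tiny)) → contradiction B∈ (tiny-nonTiny-disjoint j∈tiny j∈B)
          (inj₂ (B′ , j∈B′ , B′∈)) →
            AllPairs-toList-index {R = Disjoint} Disjoint-sym added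
              (subst (AllPairs Disjoint) (sym added-complete) queue-disjoint)
              i i′ B∈i B′∈ λ dis → dis (j∈B , j∈B′)

      output-isSchedule : IsSchedule output
      output-isSchedule j with assigned
        where
        assigned : ∃! _≡_ λ i → j ∈ H i ∪ L i
        assigned with j ∈? Ĥ
        ... | yes j∈Ĥ = heavy-assigned j∈Ĥ
        ... | no  j∉Ĥ = let i , j∈i , unique = light-assigned j∉Ĥ in
          i , q⊆p∪q (H i) (L i) j∈i , λ {i′} j∈ → case x∈p∪q⁻ (H i′) (L i′) j∈ of λ where
            (inj₁ j∈H) → contradiction (p∩q⊆q (lookup Ŝ i′) Ĥ j∈H) j∉Ĥ
            (inj₂ j∈L) → unique j∈L
      ... | i , j∈i , unique =
        i , subst (j ∈_) (sym (lookup-output i)) j∈i ,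
        λ {i′} j∈ → unique (subst (j ∈_) (lookup-output i′) j∈)

      -- The load of a single machine.

      0≤y : ∀ i → 0# ≤ lookup (tabulate y) i
      0≤y i = subst (0# ≤_) (sym (lookup∘tabulate y i))
        (size-nonNegative 0≤p̂ (lookup Ŝ i ─ Ĥ))

      -- `last` is the block that crosses `y i`, absent if the blocks received do not cross it;
      -- `full` are the blocks before it.
      record Load (i : Fin m) : Set where
        field
          full   : List (Block n)
          last   : Maybe (Block n)
          added≡ : lookup added i ≡ full ++ fromMaybe last
          full≤y : totalSize p̂ full ≤ y i

      load : ∀ i → Load i
      load i = let Us , V , eq , Us≤ = firstCrossing-load crossing 0≤y i in record
        { full = Us ; last = V ; added≡ = eq
        ; full≤y = subst (totalSize p̂ Us ≤_) (lookup∘tabulate y i) Us≤ }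

      module _ (i : Fin m) where

        open Load (load i)

        added-all : ∀ {P : Block n → Set} → All P queue → All P full × All P (fromMaybe last)
        added-all {P} all = All.++⁻ full (subst (All P) added≡
          (All.tabulate λ B∈ → All.lookup all (added⇒queue i B∈)))

        -- By `σ-injects`, at most one of the remainders sent to machine `i` is nonempty, so their
        -- concatenation is a single tiny block or empty.
        tinyJobs-≤ : ∀ {p : Scenario n} {c} → 0# ≤ c → (∀ k → blockSize p (tiny k) ≤ c) →
                     blockSize p (tinyJobs i) ≤ c
        tinyJobs-≤ {p} 0≤c tiny≤c
          with concatMap-atMostOne tiny (filter (λ k → σ k ≟ i) (allFin m))
                 (Unique.filter⁺ (λ k → σ k ≟ i) (Unique.allFin⁺ m))
                 (λ k∈ k′∈ ≢[] ≢[]′ → σ-injects ≢[] ≢[]′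
                   (trans (σ≡i k∈) (sym (σ≡i k′∈))))
          where
          σ≡i : ∀ {k} → k ∈ˡ filter (λ k → σ k ≟ i) (allFin m) → σ k ≡ i
          σ≡i k∈ = proj₂ (∈-filter⁻ (λ k → σ k ≟ i) {xs = allFin m} k∈)
        ... | inj₁ ≡[]      rewrite ≡[] = ≤.≤-respˡ-≈ (≤.Eq.sym (blockSize-[] p)) 0≤c
        ... | inj₂ (k , ≡k) rewrite ≡k  = tiny≤c k

        -- The accounting shared by both guarantees: `c` pays for the tiny block and `d` for the
        -- crossing block. Consistency takes `c` as `θ` and `d` as `3θ`, robustness takes `M` for
        -- both.
        output-size : ∀ {p : Scenario n} {c d} → NonNegative p → 0# ≤ c → 0# ≤ d →
                      (∀ k → blockSize p (tiny k) ≤ c) → All (λ B → blockSize p B ≤ d) queue →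
                      size p (lookup output i) ≤ (size p (H i) + totalSize p full) + (c + d)
        output-size {p} {c} {d} 0≤p 0≤c 0≤d tiny≤c queue≤d = begin
          size p (lookup output i)
            ≡⟨ cong (size p) (lookup-output i) ⟩
          size p (H i ∪ L i)
            ≤⟨ size-∪ 0≤p (H i) (L i) ⟩
          h + size p (L i)
            ≤⟨ +-monoʳ-≤ h (size-∪ 0≤p (jobs (tinyJobs i)) _) ⟩
          h + (blockSize p (tinyJobs i) + blockSize p (concat (lookup added i)))
            ≤⟨ +-monoʳ-≤ h (+-mono-≤ (tinyJobs-≤ 0≤c tiny≤c) added≤) ⟩
          h + (c + (totalSize p full + d))
            ≈⟨ solve 4 (λ h c t d → h :+ (c :+ (t :+ d)) := (h :+ t) :+ (c :+ d))
                 ≤.Eq.refl h c (totalSize p full) d ⟩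
          (h + totalSize p full) + (c + d)
            ∎
          where
          h = size p (H i)
          added≤ : blockSize p (concat (lookup added i)) ≤ totalSize p full + d
          added≤ = begin
            blockSize p (concat (lookup added i))         ≤⟨ blockSize-concat 0≤p (lookup added i) ⟩
            totalSize p (lookup added i)                  ≡⟨ cong (totalSize p) added≡ ⟩
            totalSize p (full ++ fromMaybe last)          ≈⟨ totalSize-++ p full ⟩
            totalSize p full + totalSize p (fromMaybe last)
              ≤⟨ +-monoʳ-≤ _ (totalSize-fromMaybe 0≤d last (proj₂ (added-all queue≤d))) ⟩
            totalSize p full + d                          ∎

        -- The blocks in `full` take the place of the light jobs of `lookup Ŝ i`, whose predicted
        -- size is `y i`, while its heavy jobs stay.
        p̂-load : size p̂ (H i) + totalSize p̂ full ≤ O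
        p̂-load = begin
          size p̂ (H i) + totalSize p̂ full  ≤⟨ +-monoʳ-≤ _ full≤y ⟩
          size p̂ (H i) + y i               ≈⟨ size-∩-─ p̂ (lookup Ŝ i) Ĥ ⟩
          size p̂ (lookup Ŝ i)              ≤⟨ Ŝ-load i ⟩
          O                                ∎

        -- The predicted load of h heavy jobs (each > 2θ) and k non-tiny blocks (each > θ)
        -- is at least θ * (2h + k), while O ≈ θ * 2Λ; hence h + k ≤ 2h + k ≤ 2Λ. If θ ≈ 0,
        -- all predicted sizes vanish, and there are no heavy jobs and no non-tiny blocks.
        robust-load : ∀ {p} → scenarios p → size p (H i) + totalSize p full ≤ M * (2# * Λ)
        robust-load {p} p∈U with θ ≤? 0#
        ... | yes θ≤0 = begin
          size p (H i) + totalSize p full    ≤⟨ +-mono-≤ H≤0 (full≤0 (proj₁ (added-all queue-θ<))) ⟩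
          0# + 0#                            ≈⟨ +-identityʳ 0# ⟩
          0#                                 ≤⟨ *-nonNegative 0≤M (proj₁ 0<2Λ) ⟩
          M * (2# * Λ)                       ∎
          where
          p̂≤0 : ∀ j → p̂ j ≤ 0#
          p̂≤0 j = begin
            p̂ j            ≤⟨ job-≤ Ŝ 0≤p̂ (proj₁ Ŝ-minimizes) Ŝ-load j ⟩
            O              ≈⟨ 2Λθ≈O ⟨
            2# * Λ * θ     ≤⟨ *-monoˡ-≤ (proj₁ 0<2Λ) θ≤0 ⟩
            2# * Λ * 0#    ≈⟨ zeroʳ (2# * Λ) ⟩
            0#             ∎
          size-0≤0 : (B : Subset n) → size (λ _ → 0#) B ≤ 0#
          size-0≤0 B = ≤.reflexive (≤.Eq.trans (size-const 0# B) (zeroˡ _))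
          H≤0 : size p (H i) ≤ 0#
          H≤0 = ≤.trans
            (size-mono-∈ (H i) λ {j} j∈ → contradiction (∈Ĥ⇒> (p∩q⊆q (lookup Ŝ i) Ĥ j∈))
              (≤⇒≯ (≤.trans (p̂≤0 j) (0≤x/c 0<Λ (0≤OPT 0≤p̂)))))
            (size-0≤0 (H i))
          full≤0 : ∀ {Bs} → All (λ B → θ < blockSize p̂ B) Bs → totalSize p Bs ≤ 0#
          full≤0 []                = ≤.refl
          full≤0 (_∷_ {B} θ<B _) = contradiction θ<B (≤⇒≯ (begin
            blockSize p̂ B  ≤⟨ size-mono p̂≤0 (jobs B) ⟩
            size _ (jobs B) ≤⟨ size-0≤0 (jobs B) ⟩
            0#             ≤⟨ 0≤O/2Λ ⟩
            θ              ∎))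
        ... | no θ≰0 = begin
          X + K
            ≤⟨ +-monoˡ-≤ K (x≤x+y X (size-nonNegative (nonNegative p p∈U) (H i))) ⟩
          (X + X) + K
            ≤⟨ +-mono-≤ (+-mono-≤ X≤ X≤) (totalSize-≤ (proj₁ (added-all (queue-≤M p∈U)))) ⟩
          (M * h + M * h) + M * k
            ≈⟨ solve 3 (λ M h k → (M :* h :+ M :* h) :+ M :* k := M :* ((h :+ h) :+ k))
                 ≤.Eq.refl M h k ⟩
          M * ((h + h) + k)
            ≤⟨ *-monoˡ-≤ 0≤M 2h+k≤2Λ ⟩
          M * (2# * Λ)
            ∎
          where
          X = size p (H i)
          K = totalSize p full
          h = size (λ _ → 1#) (H i)
          k = count full
          X≤ : X ≤ M * h
          X≤ = ≤.≤-respʳ-≈ (size-const M (H i)) (size-mono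
            (job-≤ T (nonNegative p p∈U) (proj₁ T-minimizes) (T-load p∈U)) (H i))
          heavy≥ : (θ + θ) * h ≤ size p̂ (H i)
          heavy≥ = ≤.≤-respˡ-≈ (size-const (θ + θ) (H i)) (size-mono-∈ (H i) λ j∈ →
            ≤.≤-respˡ-≈ O/Λ≈θ+θ (proj₁ (∈Ĥ⇒> (p∩q⊆q (lookup Ŝ i) Ĥ j∈))))
          2h+k≤2Λ : (h + h) + k ≤ 2# * Λ
          2h+k≤2Λ = *-cancelˡ-≤ (≰⇒> θ≰0) (begin
            θ * ((h + h) + k)
              ≈⟨ solve 3 (λ θ h k → θ :* ((h :+ h) :+ k) := (θ :+ θ) :* h :+ θ :* k)
                   ≤.Eq.refl θ h k ⟩
            (θ + θ) * h + θ * k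
              ≤⟨ +-mono-≤ heavy≥ (totalSize-≥ (All.map proj₁ (proj₁ (added-all queue-θ<)))) ⟩
            size p̂ (H i) + totalSize p̂ full
              ≤⟨ p̂-load ⟩
            O
              ≈⟨ 2Λθ≈O ⟨
            2# * Λ * θ
              ≈⟨ *-comm (2# * Λ) θ ⟩
            θ * (2# * Λ)
              ∎)

      -- The two guarantees.

      consistency : Cmax output p̂ ≤ (1# + 2# / Λ) * O
      consistency = maximum-least (λ i → size p̂ (lookup output i)) λ i → begin
        size p̂ (lookup output i)
          ≤⟨ output-size i 0≤p̂ 0≤O/2Λ 0≤3θ (chop-remainder-≤ ∘ chop) queue-≤3θ ⟩
        (size p̂ (H i) + totalSize p̂ (Load.full (load i))) + (θ + (θ + (θ + θ)))
          ≤⟨ +-monoˡ-≤ _ (p̂-load i) ⟩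
        O + (θ + (θ + (θ + θ)))
          ≈⟨ solve 2 (λ O θ → O :+ (θ :+ (θ :+ (θ :+ θ))) := O :+ ((θ :+ θ) :+ (θ :+ θ)))
               ≤.Eq.refl O θ ⟩
        O + ((θ + θ) + (θ + θ))
          -- The excess `4θ` is twice `O / Λ`, which produces the term `2 / Λ`.
          ≈⟨ +-cong (*-identityˡ O) (+-cong O/Λ≈θ+θ O/Λ≈θ+θ) ⟨
        1# * O + (O / Λ + O / Λ)
          ≈⟨ +-congˡ (2#*x≈x+x (O / Λ)) ⟨
        1# * O + 2# * (O / Λ)
          ≈⟨ +-congˡ (solve 3 (λ t O l → t :* (O :* l) := (t :* l) :* O) ≤.Eq.refl 2# O (Λ ⁻¹)) ⟩
        1# * O + (2# / Λ) * O
          ≈⟨ distribʳ O 1# (2# / Λ) ⟨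
        (1# + 2# / Λ) * O
          ∎
        where
        0≤3θ : 0# ≤ θ + (θ + θ)
        0≤3θ = ≤.trans 0≤O/2Λ (x≤x+y θ (≤.trans 0≤O/2Λ (x≤x+y θ 0≤O/2Λ)))

      robustness : worstCase U output ≤ (2# * Λ + 4#) * M
      -- The worst case is a least upper bound, so it suffices to bound the makespan in each
      -- scenario.
      robustness = proj₂ (proj₂ (worstCase-supremum U output)) _
        λ x (p , p∈U , x≈) → ≤.≤-respˡ-≈ (≤.Eq.sym x≈)
          (maximum-least (λ i → size p (lookup output i)) λ i → begin
          size p (lookup output i)
            ≤⟨ output-size i (nonNegative p p∈U) 0≤M 0≤M
                 (λ k → ≤.trans (blockSize-⊆ (nonNegative p p∈U) (tiny k) (R⇒T ∘ tiny⇒R))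
                                (T-load p∈U k))
                 (queue-≤M p∈U) ⟩
          (size p (H i) + totalSize p (Load.full (load i))) + (M + M)
            -- The load is at most `(2Λ + 2) M`; a further `M + M` brings the bound to the stated
            -- constant `2Λ + 4`.
            ≤⟨ +-mono-≤ (robust-load i p∈U) (x≤x+y (M + M) (≤.trans 0≤M (x≤x+y M 0≤M))) ⟩
          M * (2# * Λ) + ((M + M) + (M + M))
            ≈⟨ +-cong (*-comm M (2# * Λ)) (≤.Eq.sym (4#*x≈x+x+[x+x] M)) ⟩
          (2# * Λ) * M + 4# * M
            ≈⟨ distribʳ M (2# * Λ) 4# ⟨
          (2# * Λ + 4#) * M
            ∎)

theorem11 :
    (ℝ : CompleteOrderedField) →
    let open CompleteOrderedField ℝ
        open Scheduling ℝ
        2# = 1# + 1#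
        4# = 2# + 2#
    in
    (Λ : Carrier) → 0# < Λ →
    (m n : ℕ) .{{_ : NonZero m}} .{{_ : NonZero n}} →
    (U : UncertaintySet n) (p̂ : Scenario n) → UncertaintySet.scenarios U p̂ →
    BlockPacking m p̂ U Λ ×
    ((run : BlockPacking m p̂ U Λ) →
      let S = BlockPacking.output run in
      IsSchedule S ×
      Cmax S p̂ ≤ (1# + 2# / Λ) * OPT m p̂ ×
      worstCase U S ≤ (2# * Λ + 4#) * OPTʳᵒᵇ U m)
theorem11 ℝ Λ 0<Λ m n U p̂ p̂∈U =
  run-exists 0<Λ p̂∈U , λ run →
    output-isSchedule 0<Λ p̂∈U run , consistency 0<Λ p̂∈U run , robustness 0<Λ p̂∈U run
  where open BlockPackingProperties ℝ
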